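{- Let $0<\varepsilon\leq 1$. There is a deterministic polynomial-time (Karp) reduction from the subset-sum problem $\mathsf{SS}$ to $(2-\varepsilon)$-$\mathsf{GapSVP}_{\infty}$ that reduces instances with $n$ weights to instances with a lattice of rank $O_{\varepsilon}(n)$ (i.e. at most a constant depending only on $\varepsilon$ times $n$).
   Context: $\mathbb{N}$ denotes the positive integers. Subset-sum problem $\mathsf{SS}$: given $s\in\mathbb{N}$ and non-negative integers $a_1,\ldots,a_n$ (the weights), decide whether there exists $(x_1,\ldots,x_n)\in\{0,1\}^n$ with $\sum_{i=1}^n a_ix_i=s$ (YES-instance) or not (NO-instance). A lattice $\mathcal{L}$ of rank $n$ and dimension $m$ is the set of all integer linear combinations of linearly independent vectors $\mathbf{b}_1,\ldots,\mathbf{b}_n\in\mathbb{R}^m$. Let $\|\mathbf{x}\|_\infty=\max_i|x_i|$ and $\lambda_{1,\infty}(\mathcal{L})=\min_{\mathbf{v}\in\mathcal{L}\setminus\{0\}}\|\mathbf{v}\|_\infty$. For $\gamma\ge1$, the promise problem $\gamma$-$\mathsf{GapSVP}_\infty$ is: given a lattice $\mathcal{L}$ and a distance threshold $\delta>0$, decide whether $\lambda_{1,\infty}(\mathcal{L})\le\delta$ (YES-instance) or $\lambda_{1,\infty}(\mathcal{L})>\gamma\delta$ (NO-instance), when one of these cases is promised to hold. A reduction to a promise problem maps YES-instances to YES-instances and NO-instances to NO-instances. -}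

module Defs where

open import Data.Bool.Base using (Bool; true; false)
open import Data.Empty using (⊥)
open import Data.Fin.Base using (Fin; toℕ)
open import Data.Integer.Base as ℤ using (ℤ; +_; -[1+_])
open import Data.List.Base as List using (List; []; _∷_; _++_; length)
open import Data.Maybe.Base using (Maybe; just; nothing)
open import Data.Nat.Base as ℕ using (ℕ; zero; suc)
import Data.Nat.Properties as ℕₚ
open import Data.Product using (Σ; ∃; ∃-syntax; _×_; _,_; proj₁; proj₂)
open import Data.Rational.Base as ℚ using (ℚ; mkℚ; 0ℚ; 1ℚ; Positive; ↥_; ↧ₙ_)
open import Data.Rational.Literals using (fromℤ)
import Data.Rational.Properties as ℚₚ
open import Data.Sum.Base using (_⊎_; inj₁; inj₂)
open import Data.Vec.Base as Vec using (Vec; []; _∷_)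
open import Data.Vec.Functional as Vector using (Vector)
open import Relation.Binary.Definitions using (tri<; tri≈; tri>)
open import Relation.Binary.PropositionalEquality
  using (_≡_; refl; sym; trans; cong; subst)
open import Relation.Nullary using (¬_)

open import Algebra.Properties.CommutativeMonoid.Sum ℕₚ.+-0-commutativeMonoid
  using () renaming (sum to ∑ℕ)
open import Algebra.Properties.CommutativeMonoid.Sum ℚₚ.+-0-commutativeMonoid
  using () renaming (sum to ∑ℚ)

------------------------------------------------------------------------
-- Real numbers: two-sided Dedekind cuts of ℚ

record ℝ : Set₁ where
  field
    L U         : ℚ → Set
    L-inhabited : ∃ L
    U-inhabited : ∃ U
    L-lower     : ∀ {p q} → p ℚ.< q → L q → L p
    U-upper     : ∀ {p q} → p ℚ.< q → U p → U q
    L-open      : ∀ {p} → L p → ∃[ q ] (p ℚ.< q × L q)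
    U-open      : ∀ {q} → U q → ∃[ p ] (p ℚ.< q × U p)
    disjoint    : ∀ {q} → L q → U q → ⊥
    located     : ∀ {p q} → p ℚ.< q → L p ⊎ U q

open ℝ

infix 4 _<ℝ_ _≤ℝ_

_<ℝ_ : ℝ → ℝ → Set
x <ℝ y = ∃[ q ] (U x q × L y q)

_≤ℝ_ : ℝ → ℝ → Set
x ≤ℝ y = ∀ q → L x q → L y q

private
  p<p+1 : ∀ p → p ℚ.< p ℚ.+ 1ℚ
  p<p+1 p = subst (ℚ._< p ℚ.+ 1ℚ) (ℚₚ.+-identityʳ p)
    (ℚₚ.+-monoʳ-< p (ℚₚ.positive⁻¹ 1ℚ))

  p-1<p : ∀ p → p ℚ.- 1ℚ ℚ.< p
  p-1<p p = subst (p ℚ.- 1ℚ ℚ.<_) (ℚₚ.+-identityʳ p)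
    (ℚₚ.+-monoʳ-< p (ℚₚ.negative⁻¹ (ℚ.- 1ℚ)))

fromℚ : ℚ → ℝ
fromℚ r .L q = q ℚ.< r
fromℚ r .U q = r ℚ.< q
fromℚ r .L-inhabited = r ℚ.- 1ℚ , p-1<p r
fromℚ r .U-inhabited = r ℚ.+ 1ℚ , p<p+1 r
fromℚ r .L-lower = ℚₚ.<-trans
fromℚ r .U-upper p<q r<p = ℚₚ.<-trans r<p p<q
fromℚ r .L-open p<r with m , p<m , m<r ← ℚₚ.<-dense p<r = m , p<m , m<r
fromℚ r .U-open r<q with m , r<m , m<q ← ℚₚ.<-dense r<q = m , m<q , r<m
fromℚ r .disjoint q<r r<q = ℚₚ.<-asym q<r r<q
fromℚ r .located {p} {q} p<q with ℚₚ.<-cmp p r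
... | tri< p<r _ _   = inj₁ p<r
... | tri≈ _ refl _  = inj₂ p<q
... | tri> _ _ r<p   = inj₂ (ℚₚ.<-trans r<p p<q)

private
  -- Image of a cut under an increasing, resp. decreasing, bijection f of ℚ
  -- with inverse g.
  module _ (f g : ℚ → ℚ) (gf : ∀ q → g (f q) ≡ q) (fg : ∀ q → f (g q) ≡ q) where

    increasing : (∀ {p q} → p ℚ.< q → f p ℚ.< f q) →
                 (∀ {p q} → p ℚ.< q → g p ℚ.< g q) → ℝ → ℝ
    increasing f↑ g↑ x .L q = L x (g q)
    increasing f↑ g↑ x .U q = U x (g q)
    increasing f↑ g↑ x .L-inhabited with q , l ← L-inhabited x =
      f q , subst (L x) (sym (gf q)) l
    increasing f↑ g↑ x .U-inhabited with q , u ← U-inhabited x =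
      f q , subst (U x) (sym (gf q)) u
    increasing f↑ g↑ x .L-lower p<q = L-lower x (g↑ p<q)
    increasing f↑ g↑ x .U-upper p<q = U-upper x (g↑ p<q)
    increasing f↑ g↑ x .L-open {p} l with q , gp<q , lq ← L-open x l =
      f q , subst (ℚ._< f q) (fg p) (f↑ gp<q) , subst (L x) (sym (gf q)) lq
    increasing f↑ g↑ x .U-open {q} u with p , p<gq , up ← U-open x u =
      f p , subst (f p ℚ.<_) (fg q) (f↑ p<gq) , subst (U x) (sym (gf p)) up
    increasing f↑ g↑ x .disjoint = disjoint x
    increasing f↑ g↑ x .located p<q = located x (g↑ p<q)

    decreasing : (∀ {p q} → p ℚ.< q → f q ℚ.< f p) →
                 (∀ {p q} → p ℚ.< q → g q ℚ.< g p) → ℝ → ℝ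
    decreasing f↓ g↓ x .L q = U x (g q)
    decreasing f↓ g↓ x .U q = L x (g q)
    decreasing f↓ g↓ x .L-inhabited with q , u ← U-inhabited x =
      f q , subst (U x) (sym (gf q)) u
    decreasing f↓ g↓ x .U-inhabited with q , l ← L-inhabited x =
      f q , subst (L x) (sym (gf q)) l
    decreasing f↓ g↓ x .L-lower p<q = U-upper x (g↓ p<q)
    decreasing f↓ g↓ x .U-upper p<q = L-lower x (g↓ p<q)
    decreasing f↓ g↓ x .L-open {p} u with q , q<gp , uq ← U-open x u =
      f q , subst (ℚ._< f q) (fg p) (f↓ q<gp) , subst (U x) (sym (gf q)) uq
    decreasing f↓ g↓ x .U-open {q} l with p , gq<p , lp ← L-open x l =
      f p , subst (f p ℚ.<_) (fg q) (f↓ gq<p) , subst (L x) (sym (gf p)) lp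
    decreasing f↓ g↓ x .disjoint l u = disjoint x u l
    decreasing f↓ g↓ x .located p<q with located x (g↓ p<q)
    ... | inj₁ l = inj₂ l
    ... | inj₂ u = inj₁ u

  r-[r-q] : ∀ r q → r ℚ.- (r ℚ.- q) ≡ q
  r-[r-q] r q = trans (cong (r ℚ.+_) (trans (ℚₚ.neg-distrib-+ r (ℚ.- q))
                                            (cong (ℚ.- r ℚ.+_) (neg-neg q))))
                (trans (sym (ℚₚ.+-assoc r (ℚ.- r) q))
                (trans (cong (ℚ._+ q) (ℚₚ.+-inverseʳ r)) (ℚₚ.+-identityˡ q)))
    where
    neg-neg : ∀ q → ℚ.- (ℚ.- q) ≡ q
    neg-neg (mkℚ (+ zero) _ _)  = refl
    neg-neg (mkℚ (+ suc _) _ _) = refl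
    neg-neg (mkℚ -[1+ _ ] _ _)  = refl

  r-↓ : ∀ r {p q} → p ℚ.< q → r ℚ.- q ℚ.< r ℚ.- p
  r-↓ r p<q = ℚₚ.+-monoʳ-< r (ℚₚ.neg-antimono-< p<q)

infix 7 _-ℝ_
infixl 8 _·ℝ_

_-ℝ_ : ℚ → ℝ → ℝ
r -ℝ x = decreasing (λ q → r ℚ.- q) (λ q → r ℚ.- q) (r-[r-q] r) (r-[r-q] r) (r-↓ r) (r-↓ r) x

_·ℝ_ : ℝ → (δ : ℚ) → .{{Positive δ}} → ℝ
x ·ℝ δ = increasing (ℚ._* δ) (ℚ._* δ⁻¹)
  (λ q → cancel q δ δ⁻¹ (ℚₚ.*-inverseʳ δ {{nz}}))
  (λ q → cancel q δ⁻¹ δ (ℚₚ.*-inverseˡ δ {{nz}}))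
  (ℚₚ.*-monoˡ-<-pos δ)
  (ℚₚ.*-monoˡ-<-pos δ⁻¹ {{ℚₚ.1/pos⇒pos δ}}) x
  where
  nz = ℚₚ.pos⇒nonZero δ
  δ⁻¹ = (ℚ.1/ δ) {{nz}}
  cancel : ∀ q a b → a ℚ.* b ≡ 1ℚ → q ℚ.* a ℚ.* b ≡ q
  cancel q a b ab≡1 =
    trans (ℚₚ.*-assoc q a b) (trans (cong (q ℚ.*_) ab≡1) (ℚₚ.*-identityʳ q))

------------------------------------------------------------------------
-- Words

data Symbol : Set where
  bit                              : Bool → Symbol
  plus minus slash comma semicolon : Symbol

Word : Set
Word = List Symbol

increment : List Bool → List Bool
increment []           = true ∷ []
increment (false ∷ bs) = true ∷ bs
increment (true ∷ bs)  = false ∷ increment bs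

-- Binary expansion, least significant bit first, without superfluous
-- zeros; in particular 0 is the empty word.
bits : ℕ → List Bool
bits zero    = []
bits (suc n) = increment (bits n)

encodeℕ : ℕ → Word
encodeℕ n = List.map bit (bits n)

encodeℤ : ℤ → Word
encodeℤ (+ n)    = plus ∷ encodeℕ n
encodeℤ -[1+ n ] = minus ∷ encodeℕ (suc n)

encodeℚ : ℚ → Word
encodeℚ q = encodeℤ (↥ q) ++ slash ∷ encodeℕ (↧ₙ q)

encodeVector : ∀ {A : Set} {n} → (A → Word) → Symbol → Vector A n → Word
encodeVector enc terminator v =
  List.concat (Vector.toList (λ i → enc (v i) ++ terminator ∷ []))

------------------------------------------------------------------------
-- Deterministic multitape Turing machines

data Direction : Set where
  left right stay : Direction

-- nothing is the blank; inj₂ gives auxiliary tape symbols.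
Cell : ℕ → Set
Cell g = Maybe (Symbol ⊎ Fin g)

-- A two-way infinite tape: the cells to the left of the head (nearest
-- first), the scanned cell, and the cells to its right (nearest first).
-- All cells beyond the two lists are blank.
record Tape (g : ℕ) : Set where
  constructor tape
  field
    before  : List (Cell g)
    scanned : Cell g
    after   : List (Cell g)

open Tape

move : ∀ {g} → Direction → Tape g → Tape g
move left  (tape []       c rs)       = tape [] nothing (c ∷ rs)
move left  (tape (l ∷ ls) c rs)       = tape ls l (c ∷ rs)
move right (tape ls       c [])       = tape (c ∷ ls) nothing []
move right (tape ls       c (r ∷ rs)) = tape (c ∷ ls) r rs
move stay  t                          = t

writeMove : ∀ {g} → Tape g → Cell g × Direction → Tape g
writeMove t (c , d) = move d (record t { scanned = c })

-- Tape 0 is the input tape, tape 1 the output tape, the others are work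
-- tapes. All tapes may be read and written. The machine halts when the
-- transition function returns nothing.
record Machine : Set where
  field
    workTapes workSymbols states : ℕ
    start : Fin states

  tapes : ℕ
  tapes = 2 ℕ.+ workTapes

  field
    transition : Fin states → Vec (Cell workSymbols) tapes →
                 Maybe (Fin states × Vec (Cell workSymbols × Direction) tapes)

module Execution (M : Machine) where
  open Machine M

  record Configuration : Set where
    constructor configuration
    field
      state    : Fin states
      contents : Vec (Tape workSymbols) tapes

  open Configuration

  blankTape : Tape workSymbols
  blankTape = tape [] nothing []

  inputTape : Word → Tape workSymbols
  inputTape []      = blankTape
  inputTape (a ∷ w) = tape [] (just (inj₁ a)) (List.map (λ b → just (inj₁ b)) w)

  initial : Word → Configuration
  initial w = configuration start (inputTape w ∷ Vec.replicate _ blankTape)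

  next : Configuration → Maybe Configuration
  next (configuration q ts) with transition q (Vec.map scanned ts)
  ... | nothing         = nothing
  ... | just (q′ , acts) = just (configuration q′ (Vec.zipWith writeMove ts acts))

  Halted : Configuration → Set
  Halted c = next c ≡ nothing

  -- The configuration after t steps, a halted machine staying as it is.
  run : ℕ → Configuration → Configuration
  run zero    c = c
  run (suc t) c with next c
  ... | nothing = c
  ... | just c′ = run t c′

  -- The longest word over Symbol starting at the head.
  readWord : Tape workSymbols → Word
  readWord t = go (scanned t ∷ after t)
    where
    go : List (Cell workSymbols) → Word
    go (just (inj₁ a) ∷ cs) = a ∷ go cs
    go _                    = []

  output : Configuration → Word
  output c = readWord (Vec.head (Vec.tail (contents c)))

  -- On input w the machine halts within t steps with output v.
  Computes_↦_within_ : Word → Word → ℕ → Set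
  Computes w ↦ v within t = Halted c × output c ≡ v
    where c = run t (initial w)

------------------------------------------------------------------------
-- Promise problems and Karp reductions

record PromiseProblem : Set₁ where
  field
    Instance : Set
    encode   : Instance → Word
    Yes No   : Instance → Set

open PromiseProblem

-- f is computable by a deterministic machine whose running time is
-- polynomial in the length of the encoded instance.
PolyTime : (P Q : PromiseProblem) → (Instance P → Instance Q) → Set
PolyTime P Q f =
  Σ Machine λ M → ∃[ c ] ∃[ d ] (∀ I →
    let w = encode P I in
    Execution.Computes_↦_within_ M w (encode Q (f I))
      (c ℕ.* length w ℕ.^ d ℕ.+ c))

record _≤ᴷᵃʳᵖ_ (P Q : PromiseProblem) : Set where
  field
    reduce   : Instance P → Instance Q
    polyTime : PolyTime P Q reduce
    yes      : ∀ I → Yes P I → Yes Q (reduce I)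
    no       : ∀ I → No P I → No Q (reduce I)

------------------------------------------------------------------------
-- Subset sum

record SSInstance : Set where
  field
    n            : ℕ
    {{n-nonZero}} : ℕ.NonZero n
    s            : ℕ
    {{s-nonZero}} : ℕ.NonZero s
    a            : Vector ℕ n

HasSubsetSum : SSInstance → Set
HasSubsetSum I = Σ (Vector (Fin 2) n) λ x → ∑ℕ (λ i → a i ℕ.* toℕ (x i)) ≡ s
  where open SSInstance I

SS : PromiseProblem
SS .Instance = SSInstance
SS .encode I = encodeℕ s ++ comma ∷ encodeVector encodeℕ comma a
  where open SSInstance I
SS .Yes I = HasSubsetSum I
SS .No I  = ¬ HasSubsetSum I

------------------------------------------------------------------------
-- Lattices

LinearlyIndependent : ∀ {n m} → Vector (Vector ℚ m) n → Set
LinearlyIndependent {n} b = (c : Vector ℚ n) →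
  (∀ j → ∑ℚ (λ i → c i ℚ.* b i j) ≡ 0ℚ) → ∀ i → c i ≡ 0ℚ

-- Lattices are presented by a finitely encodable, hence rational, basis;
-- for rational vectors linear independence over ℚ and over ℝ coincide.
record Lattice : Set where
  field
    rank             : ℕ
    {{rank-nonZero}} : ℕ.NonZero rank
    dim              : ℕ
    basis            : Vector (Vector ℚ dim) rank
    independent      : LinearlyIndependent basis

  -- All lattice vectors are rational, as the basis is.
  _∈ᴸ : Vector ℚ dim → Set
  v ∈ᴸ = Σ (Vector ℤ rank) λ z →
    ∀ j → v j ≡ ∑ℚ (λ i → fromℤ (z i) ℚ.* basis i j)

NonZeroVector : ∀ {m} → Vector ℚ m → Set
NonZeroVector v = ¬ (∀ j → v j ≡ 0ℚ)

‖_‖∞ : ∀ {m} → Vector ℚ m → ℚ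
‖ v ‖∞ = Vector.foldr ℚ._⊔_ 0ℚ (λ j → ℚ.∣ v j ∣)

-- λ₁,∞ as a graph: r is the minimum of ‖ v ‖∞ over nonzero lattice vectors.
λ₁∞_≈_ : Lattice → ℚ → Set
λ₁∞ 𝓛 ≈ r =
  (∃[ v ] (v ∈ᴸ × NonZeroVector v × ‖ v ‖∞ ≡ r)) ×
  (∀ v → v ∈ᴸ → NonZeroVector v → r ℚ.≤ ‖ v ‖∞)
  where open Lattice 𝓛

record GapSVPInstance : Set where
  field
    lattice        : Lattice
    δ              : ℚ
    {{δ-positive}} : Positive δ

  open Lattice lattice public

GapSVP∞ : ℝ → PromiseProblem
GapSVP∞ γ .Instance = GapSVPInstance
GapSVP∞ γ .encode I =
  encodeℚ δ ++ semicolon ∷ encodeVector (encodeVector encodeℚ comma) semicolon basis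
  where open GapSVPInstance I
GapSVP∞ γ .Yes I = ∃[ r ] ((λ₁∞ lattice ≈ r) × r ℚ.≤ δ)
  where open GapSVPInstance I
GapSVP∞ γ .No I  = ∃[ r ] ((λ₁∞ lattice ≈ r) × γ ·ℝ δ <ℝ fromℚ r)
  where open GapSVPInstance I

{-# OPTIONS --safe #-}

-- Write SS as ∑ aᵢxᵢ = s and consider the integer vectors with coordinates
-- 2 (z₀ s + ∑ zᵢ aᵢ), z₀ and z₀ + 2 zᵢ for all i. A solution x gives the vector
-- with z₀ = -1 and zᵢ = xᵢ, of norm 1. Conversely, all coordinates of a nonzero
-- vector of norm at most 1 being small, z₀ = ±1 (z₀ = 0 forces z = 0), every
-- -z₀ zᵢ is 0 or 1, and the first coordinate, being even, vanishes: the -z₀ zᵢ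
-- solve the instance. So λ₁ is 1 for YES-instances and at least 2 otherwise, and
-- a further weight 0 makes it exactly 2, since its basis vector has norm 2.
-- The reduction does not depend on ε.
--
-- With the columns of the zᵢ in reverse order, each row of the basis after the
-- first two is obtained by moving the 2 one place to the left, which is how the
-- Turing machine produces them from a work tape holding one row.
module Submission where

open import Defs

open import Data.Bool.Base using (Bool; true; false; if_then_else_)
open import Data.Fin.Base using (Fin; zero; suc; toℕ; fromℕ; inject₁; opposite)
open import Data.Fin.Patterns using (0F; 1F; 2F)
open import Data.Fin.Properties
  using (toℕ-fromℕ; toℕ-inject₁; toℕ-injective; toℕ<n; opposite-involutive; ¬∀⟶∃¬)
open import Data.Integer.Base as ℤ using (ℤ; +_; -[1+_]; 0ℤ; 1ℤ)
import Data.Integer.Properties as ℤₚ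
open import Data.List.Base as List using (List; []; _∷_; _++_; _ʳ++_; length; replicate; concat)
open import Data.List.Properties
  using (++-ʳ++; ++-assoc; ++-identityʳ; length-++; length-map; length-reverse; length-tabulate;
         reverse-involutive; tabulate-cong)
open import Data.Maybe.Base using (Maybe; just; nothing)
open import Data.Nat.Base using (ℕ; zero; suc; _+_; _*_; _^_; _≤_; z≤n; s≤s; >-nonZero; >-nonZero⁻¹)
open import Data.Nat.Properties as ℕₚ
  using (m≤m+n; m≤n+m; n≤1+n; m≤m*n; m≤n⇒m≤1+n; ≤-refl; ≤-reflexive; ≤-trans; <⇒≤; +-suc; *-identityʳ;
         +-mono-≤; +-monoˡ-≤; +-monoʳ-≤; *-mono-≤; *-monoʳ-≤; module ≤-Reasoning)
open import Data.Nat.Tactic.RingSolver using (solve-∀)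
open import Data.Product using (Σ; ∃; _×_; _,_; proj₁; proj₂)
open import Data.Rational.Base as ℚ using (ℚ; 0ℚ; 1ℚ; *≤*; ∣_∣; _/_)
open import Data.Rational.Literals using (fromℤ)
import Data.Rational.Properties as ℚₚ
import Data.Rational.Unnormalised.Base as ℚᵘ
import Data.Rational.Unnormalised.Properties as ℚᵘₚ
open import Data.Sum.Base using (inj₁; inj₂)
open import Data.Vec.Base as Vec using (Vec; []; _∷_)
open import Data.Vec.Functional as Vector using (Vector)
open import Relation.Binary.PropositionalEquality
open import Relation.Nullary using (¬_; contradiction; does)
open import Relation.Nullary.Decidable using (dec-true; dec-false)
open import Algebra.Properties.CommutativeMonoid.Sum ℕₚ.+-0-commutativeMonoid
  using () renaming (sum to ∑ℕ; sum-init-last to ∑ℕ-init-last; sum-cong-≗ to ∑ℕ-cong)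
open import Algebra.Properties.CommutativeMonoid.Sum ℤₚ.+-0-commutativeMonoid
  using () renaming (sum to ∑ℤ)
open import Algebra.Properties.CommutativeMonoid.Sum ℚₚ.+-0-commutativeMonoid
  using () renaming (sum to ∑ℚ)

-- The Turing machine

pattern `_ a = just (inj₁ a)
pattern aux c = just (inj₂ c)

pattern c0 = aux 0F
pattern c1 = aux 1F
pattern c2 = aux 2F

pattern header₀    = zero
pattern header₁    = suc header₀
pattern header₂    = suc header₁
pattern header₃    = suc header₂
pattern header₄    = suc header₃
pattern count      = suc header₄
pattern rewind     = suc count
pattern number     = suc rewind
pattern double     = suc number
pattern digits     = suc double
pattern twoDigit   = suc digits
pattern oneDigit   = suc twoDigit
pattern slashSign  = suc oneDigit
pattern denom      = suc slashSign
pattern separator  = suc denom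
pattern scan       = suc separator
pattern back       = suc scan
pattern put        = suc back
pattern finish     = suc put
pattern halt       = suc finish

State : Set
State = Fin 20

Action : Set
Action = Maybe (State × Vec (Cell 3 × Direction) 3)

emit : Symbol → State → Cell 3 → Cell 3 → Action
emit a q i c = just (q , (i , stay) ∷ (` a , right) ∷ (c , stay) ∷ [])

-- The arguments are the state and the scanned cells of the input, output
-- and work tapes. The work cells 0, 1, 2 hold the entries of the current row
-- after its first one: `scan` outputs them from left to right, and on the way
-- `back` the 2 is shifted one cell to the left. The semicolon at the right end
-- of the initial row of ones brings in the first 2.
act : State → Cell 3 → Cell 3 → Cell 3 → Action
act header₀ i o c = just (header₁ , (i , stay) ∷ (` plus , right) ∷ (` semicolon , left) ∷ [])
act header₁ i o c = emit (bit true) header₂ i c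
act header₂ i o c = emit slash header₃ i c
act header₃ i o c = emit (bit true) header₄ i c
act header₄ i o c = emit semicolon count i c
act count (` comma) o c = just (count , (` comma , right) ∷ (o , stay) ∷ (c1 , left) ∷ [])
-- The input has one comma for `s` and one per weight. The blank adds another 1, so the row of a
-- reduction from n weights has n + 2 entries: the homogenising column, n weights and the added
-- weight.
act count nothing   o c = just (rewind , (nothing , left) ∷ (o , stay) ∷ (c1 , left) ∷ [])
act count i         o c = just (count , (i , right) ∷ (o , stay) ∷ (c , stay) ∷ [])
act rewind nothing  o c = just (number , (nothing , right) ∷ (o , stay) ∷ (c , stay) ∷ [])
act rewind i        o c = just (rewind , (i , left) ∷ (o , stay) ∷ (c , stay) ∷ [])
act number i o c = emit plus double i c
-- Least significant bits come first, so a leading `false` doubles a nonzero number; 0 is the empty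
-- word and stays empty.
act double (` (bit b)) o c = emit (bit false) digits (` (bit b)) c
act double i           o c = just (digits , (i , stay) ∷ (o , stay) ∷ (c , stay) ∷ [])
act digits (` (bit b)) o c = just (digits , (` (bit b) , right) ∷ (` (bit b) , right) ∷ (c , stay) ∷ [])
act digits i           o c = emit slash denom i c
act twoDigit  i o c = emit (bit false) oneDigit i c
act oneDigit  i o c = emit (bit true) slashSign i c
act slashSign i o c = emit slash denom i c
act denom     i o c = emit (bit true) separator i c
act separator i o c = just (scan , (i , stay) ∷ (` comma , right) ∷ (c , right) ∷ [])
act scan i o c0    = emit plus slashSign i c0
act scan i o c1    = emit plus oneDigit i c1
act scan i o c2    = emit plus twoDigit i c2
act scan i o (` a) = just (put  , (i , stay) ∷ (` semicolon , right) ∷ (nothing , left) ∷ [])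
act scan i o nothing = just (back , (i , stay) ∷ (` semicolon , right) ∷ (nothing , left) ∷ [])
act back i o c0 = just (back , (i , stay) ∷ (o , stay) ∷ (c0 , left) ∷ [])
act back i o c1 = just (back , (i , stay) ∷ (o , stay) ∷ (c0 , left) ∷ [])
act back i o c2 = just (put  , (i , stay) ∷ (o , stay) ∷ (c0 , left) ∷ [])
-- The input head is on the separator after the last number read. Past the final comma there is an
-- empty number, read as the added weight 0; only after its row is the blank met here.
act back nothing o c = just (finish , (nothing , stay) ∷ (o , left) ∷ (c , stay) ∷ [])
act back i       o c = just (number , (i , right) ∷ (o , stay) ∷ (c , stay) ∷ [])
act put i o c = just (back , (i , stay) ∷ (o , stay) ∷ (c2 , left) ∷ [])
act finish i nothing o = just (halt , (i , stay) ∷ (nothing , right) ∷ (o , stay) ∷ [])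
act finish i (` a)   o = just (finish , (i , stay) ∷ (` a , left) ∷ (o , stay) ∷ [])
act finish i c       o = nothing
act halt   i o c = nothing

machine : Machine
machine = record
  { workTapes   = 1
  ; workSymbols = 3
  ; states      = 20
  ; start       = header₀
  ; transition  = λ { q (i ∷ o ∷ c ∷ []) → act q i o c }
  }

open Execution machine

config : State → Tape 3 → Tape 3 → Tape 3 → Configuration
config q i o c = configuration q (i ∷ o ∷ c ∷ [])

-- Runs with step bounds

infix 4 _⟶[_]_

-- Reachability within at most the given number of steps.
data _⟶[_]_ : Configuration → ℕ → Configuration → Set where
  done : ∀ {c t} → c ⟶[ t ] c
  _◅_  : ∀ {c c′ c″ t} → next c ≡ just c′ → c′ ⟶[ t ] c″ → c ⟶[ suc t ] c″

infixr 5 _◅_ _◅◅_ _◅⟨_⟩_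
infixl 4 _▻_

relax : ∀ {c c′ s t} → s ≤ t → c ⟶[ s ] c′ → c ⟶[ t ] c′
relax s≤t       done      = done
relax (s≤s s≤t) (e ◅ c⟶) = e ◅ relax s≤t c⟶

_◅◅_ : ∀ {c c′ c″ s t} → c ⟶[ s ] c′ → c′ ⟶[ t ] c″ → c ⟶[ s + t ] c″
done {t = s} ◅◅ c⟶ = relax (m≤n+m _ s) c⟶
(e ◅ c⟶)     ◅◅ c⟶′ = e ◅ (c⟶ ◅◅ c⟶′)

-- The outcome of a head movement computes only after a case split on the tape; the middle equation
-- supplies a form of it that needs no split.
_◅⟨_⟩_ : ∀ {c c′ c″ d t} → next c ≡ just c′ → c′ ≡ c″ → c″ ⟶[ t ] d → c ⟶[ suc t ] d
e ◅⟨ refl ⟩ c⟶ = e ◅ c⟶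

_▻_ : ∀ {c c′ c″ t} → c ⟶[ t ] c′ → c′ ≡ c″ → c ⟶[ t ] c″
c⟶ ▻ refl = c⟶

run-halted : ∀ {c} t → Halted c → run t c ≡ c
run-halted         zero    h = refl
run-halted {c} (suc t) h with next c
run-halted {c} (suc t) refl | nothing = refl

run-reaches : ∀ {c c′ t} → c ⟶[ t ] c′ → Halted c′ → run t c ≡ c′
run-reaches {t = t} done h = run-halted t h
run-reaches {c} (e ◅ c⟶) h with next c
run-reaches {c} (refl ◅ c⟶) h | just _ = run-reaches c⟶ h

-- Tapes and head movements

tapeAt : List (Cell 3) → List (Cell 3) → Tape 3
tapeAt ls []       = tape ls nothing []
tapeAt ls (c ∷ cs) = tape ls c cs

word : Word → List (Cell 3)
word = List.map `_

-- The output tape after writing the reversal of the given word.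
out : Word → Tape 3
out r = tape (word r) nothing []

-- The tape after a move to the left, as `tapeAt` is after a move to the right; the list moved into
-- may be empty.
tapeFrom : List (Cell 3) → List (Cell 3) → Tape 3
tapeFrom []       rs = tape [] nothing rs
tapeFrom (c ∷ ls) rs = tape ls c rs

move-right : ∀ ls (c : Cell 3) rs → move right (tape ls c rs) ≡ tapeAt (c ∷ ls) rs
move-right ls c []      = refl
move-right ls c (_ ∷ _) = refl

move-left : ∀ ls (c : Cell 3) rs → move left (tape ls c rs) ≡ tapeFrom ls (c ∷ rs)
move-left []      c rs = refl
move-left (_ ∷ _) c rs = refl

private
  variable
    i : Tape 3
    r w : Word
    ls rs : List (Cell 3)

-- Passes over the work row

separate : ∀ c → config separator i (out r) (tape ls c rs) ⟶[ 1 ]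
                 config scan i (out (comma ∷ r)) (tapeAt (c ∷ ls) rs)
separate {rs = []}    c = refl ◅ done
separate {rs = _ ∷ _} c = refl ◅ done

-- The encoding of the rational v / 1 and its terminating comma.
entry : Fin 3 → Word
entry v = plus ∷ value v ++ slash ∷ bit true ∷ comma ∷ []
  where
  value : Fin 3 → Word
  value 0F = []
  value 1F = bit true ∷ []
  value 2F = bit false ∷ bit true ∷ []

scan-cell : ∀ v → config scan i (out r) (tape ls (aux v) rs) ⟶[ 6 ]
                  config scan i (out (entry v ʳ++ r)) (tapeAt (aux v ∷ ls) rs)
scan-cell 0F =
  relax (m≤m+n 4 2) (refl ◅ refl ◅ refl ◅ separate c0)
scan-cell 1F =
  relax (m≤m+n 5 1) (refl ◅ refl ◅ refl ◅ refl ◅ separate c1)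
scan-cell 2F =
  refl ◅ refl ◅ refl ◅ refl ◅ refl ◅ separate c2

replicate-∷ : ∀ {A : Set} k (x : A) xs → replicate k x ++ x ∷ xs ≡ x ∷ replicate k x ++ xs
replicate-∷ zero    x xs = refl
replicate-∷ (suc k) x xs = cong (x ∷_) (replicate-∷ k x xs)

entries : ℕ → Fin 3 → Word
entries k v = concat (replicate k (entry v))

scan-cells : ∀ k v → config scan i (out r) (tapeAt ls (replicate k (aux v) ++ rs)) ⟶[ k * 6 ]
  config scan i (out (entries k v ʳ++ r)) (tapeAt (replicate k (aux v) ++ ls) rs)
scan-cells zero v = done
scan-cells {i = i} {r = r} {ls = ls} {rs = rs} (suc k) v =
  (scan-cell v ◅◅ scan-cells k v) ▻
  cong₂ (λ r′ ls′ → config scan i (out r′) (tapeAt ls′ rs)) (sym (++-ʳ++ (entry v))) (replicate-∷ k (aux v) ls)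

-- Both 0 and 1 become 0 on the way back. The step is a hypothesis because `act` reduces only for a
-- concrete cell.
back-cell : ∀ c → (∀ {i o ls rs} → next (config back i o (tape ls c rs)) ≡
                                    just (config back i o (tapeFrom ls (c0 ∷ rs)))) →
  ∀ {o} k → config back i o (tapeFrom (replicate k c ++ ls) rs) ⟶[ k ]
            config back i o (tapeFrom ls (replicate k c0 ++ rs))
back-cell c e zero = done
back-cell {i = i} {ls = ls} {rs = rs} c e {o} (suc k) =
  (e ◅ back-cell c e k) ▻ cong (λ rs′ → config back i o (tapeFrom ls rs′)) (replicate-∷ k c0 rs)

back-zeros : ∀ {o} k → config back i o (tapeFrom (replicate k c0 ++ ls) rs) ⟶[ k ]
                       config back i o (tapeFrom ls (replicate k c0 ++ rs))
back-zeros = back-cell c0 λ { {ls = []} → refl ; {ls = _ ∷ _} → refl }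

back-ones : ∀ {o} k → config back i o (tapeFrom (replicate k c1 ++ ls) rs) ⟶[ k ]
                      config back i o (tapeFrom ls (replicate k c0 ++ rs))
back-ones = back-cell c1 λ { {ls = []} → refl ; {ls = _ ∷ _} → refl }

put-two : ∀ c {o} → config put i o (tape ls c rs) ⟶[ 1 ]
                    config back i o (tapeFrom ls (c2 ∷ rs))
put-two {ls = []}    c = refl ◅ done
put-two {ls = _ ∷ _} c = refl ◅ done

-- Copying and doubling a weight

doubled : List Bool → List Bool
doubled []       = []
doubled (b ∷ bs) = false ∷ b ∷ bs

unitSuffix : Word
unitSuffix = slash ∷ bit true ∷ comma ∷ []

numberEntry : List Bool → Word
numberEntry bs = plus ∷ List.map bit (doubled bs) ++ unitSuffix

numbers : List (List Bool) → Word
numbers []       = []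
numbers (bs ∷ l) = List.map bit bs ++ comma ∷ numbers l

copy-digits : ∀ {c} bs → config digits (tapeAt ls (word (List.map bit bs ++ w) ++ nothing ∷ [])) (out r) c ⟶[ length bs ]
  config digits (tapeAt (word (List.map bit bs) ʳ++ ls) (word w ++ nothing ∷ [])) (out (List.map bit bs ʳ++ r)) c
copy-digits []       = done
copy-digits {ls = ls} {c = c} (b ∷ bs) = refl ◅⟨ cong (λ i → config digits i _ c) (move-right ls _ _) ⟩ copy-digits bs

-- What may follow a number on the input tape. Either case ends the copying, but `act` must see the
-- actual cell in order to reduce.
data Boundary : Word → Set where
  end  : Boundary []
  more : Boundary (comma ∷ w)

start-digits : ∀ {o c} → Boundary w →
  config double (tapeAt ls (word w ++ nothing ∷ [])) o c ⟶[ 1 ]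
  config digits (tapeAt ls (word w ++ nothing ∷ [])) o c
start-digits end  = refl ◅ done
start-digits more = refl ◅ done

end-digits : ∀ {cs} → Boundary w →
  config digits (tapeAt ls (word w ++ nothing ∷ [])) (out r) (tape [] nothing cs) ⟶[ 3 ]
  config scan (tapeAt ls (word w ++ nothing ∷ [])) (out (unitSuffix ʳ++ r)) (tapeAt (nothing ∷ []) cs)
end-digits end  = refl ◅ refl ◅ separate nothing
end-digits more = refl ◅ refl ◅ separate nothing

number-run : ∀ {cs} bs → Boundary w →
  config number (tapeAt ls (word (List.map bit bs ++ w) ++ nothing ∷ [])) (out r) (tape [] nothing cs) ⟶[ length bs + 5 ]
  config scan (tapeAt (word (List.map bit bs) ʳ++ ls) (word w ++ nothing ∷ []))
    (out (numberEntry bs ʳ++ r)) (tapeAt (nothing ∷ []) cs)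
number-run []       e = refl ◅ start-digits e ◅◅ end-digits e
number-run {w = w} {ls = ls} {cs = cs} bs@(_ ∷ _) e =
  relax (≤-reflexive (slack (length bs))) (refl ◅ refl ◅ copy-digits bs ◅◅ end-digits e) ▻
  cong (λ r → config scan (tapeAt (word (List.map bit bs) ʳ++ ls) (word w ++ nothing ∷ []))
                (out r) (tapeAt (nothing ∷ []) cs))
    (sym (++-ʳ++ (List.map bit bs)))
  where
  slack : ∀ n → 2 + (n + 3) ≡ n + 5
  slack = solve-∀

-- Rows of the basis

diagonal : ℕ → ℕ → List (Cell 3)
diagonal p q = replicate p c0 ++ c2 ∷ replicate q c0 ++ nothing ∷ []

diagonalEntries : ℕ → ℕ → Word
diagonalEntries p q = entries p 0F ++ entry 2F ++ entries q 0F ++ semicolon ∷ []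

diagonalEntries-ʳ++ : ∀ p q → diagonalEntries p q ʳ++ r ≡
  semicolon ∷ (entries q 0F ʳ++ entry 2F ʳ++ entries p 0F ʳ++ r)
diagonalEntries-ʳ++ p q =
  trans (++-ʳ++ (entries p 0F))
    (trans (++-ʳ++ (entry 2F) {ys = entries q 0F ++ semicolon ∷ []}) (++-ʳ++ (entries q 0F)))

scan-blank : config scan i (out r) (tape ls nothing []) ⟶[ 1 ]
             config back i (out (semicolon ∷ r)) (tapeFrom ls (nothing ∷ []))
scan-blank {i} {r} {ls} = refl ◅⟨ cong (config back i (out (semicolon ∷ r))) (move-left ls _ _) ⟩ done

-- The way right outputs the row; the way left moves the 2 onto the zero before it, so `p` loses
-- what `q` gains.
diagonal-run : ∀ p q →
  config scan i (out r) (tapeAt (nothing ∷ []) (diagonal (suc p) q)) ⟶[ 7 * (2 + p + q) + 1 ]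
  config back i (out (diagonalEntries (suc p) q ʳ++ r)) (tape [] nothing (diagonal p (suc q)))
diagonal-run {i = i} p q =
  relax (≤-reflexive (slack p q))
    (scan-cells (suc p) 0F ◅◅ scan-cell 2F ◅◅ scan-cells q 0F ◅◅ scan-blank
     ◅◅ back-zeros q ◅◅ refl ◅ put-two c0 ◅◅ back-zeros p) ▻
  cong (λ r → config back i (out r) (tape [] nothing (diagonal p (suc q)))) (sym (diagonalEntries-ʳ++ (suc p) q))
  where
  slack : ∀ p q → suc p * 6 + (6 + (q * 6 + (1 + (q + suc (1 + p))))) ≡ 7 * (2 + p + q) + 1
  slack = solve-∀

-- The marker at the right end leads straight to `put`, so the last 1 becomes the first 2 and the
-- other ones become zeros.
ones-run : ∀ p →
  config scan i (out r) (tapeAt (nothing ∷ []) (replicate (suc p) c1 ++ ` semicolon ∷ [])) ⟶[ 7 * suc p + 1 ]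
  config back i (out ((entries (suc p) 1F ++ semicolon ∷ []) ʳ++ r)) (tape [] nothing (diagonal p 0))
ones-run {i = i} p =
  relax (≤-reflexive (slack p)) (scan-cells (suc p) 1F ◅◅ refl ◅ put-two c1 ◅◅ back-ones p) ▻
  cong (λ r → config back i (out r) (tape [] nothing (diagonal p 0))) (sym (++-ʳ++ (entries (suc p) 1F)))
  where
  slack : ∀ p → suc p * 6 + suc (1 + p) ≡ 7 * suc p + 1
  slack = solve-∀

next-number : ∀ {o cs} → config back (tapeAt ls (word (comma ∷ w) ++ nothing ∷ [])) o (tape [] nothing cs) ⟶[ 1 ]
              config number (tapeAt (` comma ∷ ls) (word w ++ nothing ∷ [])) o (tape [] nothing cs)
next-number {ls} {w} {o} {cs} =
  refl ◅⟨ cong (λ i → config number i o (tape [] nothing cs)) (move-right ls _ _) ⟩ done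

-- `q` counts the weights already treated, whose columns lie to the right of the 2. To its left are
-- the columns of the weights still to come, the added one included, and the homogenising column.
rows : List (List Bool) → ℕ → Word
rows []       q = numberEntry [] ++ diagonalEntries 1 q
rows (bs ∷ l) q = numberEntry bs ++ diagonalEntries (2 + length l) q ++ rows l (suc q)

-- For a row of 2 + k entries: six steps to output an entry and one to walk back over it, and seven
-- for the leading number without its digits and for the turns.
rowCost : ℕ → ℕ
rowCost k = 7 * (2 + k) + 7

-- Only the output matters at the end, so the other two tapes are existential. As `length l + q` is
-- invariant, all rows have the same cost; the digits are charged to the input length.
rows-run : ∀ l q {ls r} → ∃ λ i → ∃ λ c →
  config number (tapeAt ls (word (numbers l) ++ nothing ∷ [])) (out r) (tape [] nothing (diagonal (suc (length l)) q))
    ⟶[ length (numbers l) + suc (length l) * rowCost (length l + q) ]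
  config finish i (tapeFrom (word (rows l q ʳ++ r)) (nothing ∷ [])) c
rows-run [] q {ls} {r} = input , work ,
  (relax (≤-reflexive (slack q))
    (number-run [] end ◅◅ diagonal-run 0 q ◅◅
     (refl ◅⟨ cong (λ o → config finish input o work) (move-left (word (diagonalEntries 1 q ʳ++ _)) nothing []) ⟩ done)) ▻
   cong (λ r → config finish input (tapeFrom (word r) (nothing ∷ [])) work)
     (sym (++-ʳ++ (numberEntry []) {ys = diagonalEntries 1 q})))
  where
  input = tape ls nothing []
  work = tape [] nothing (diagonal 0 (suc q))
  slack : ∀ q → 5 + (7 * (2 + q) + 1 + 1) ≡ 1 * (7 * (2 + q) + 7)
  slack = solve-∀
rows-run (bs ∷ l) q {ls} {r} =
  let i , c , run = rows-run l (suc q)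
  in i , c ,
  -- The comma counts in the input length while the step over it is already in `rowCost`, which
  -- leaves one step to spare.
  (relax (<⇒≤ (≤-reflexive total))
    (number-run bs more ◅◅ diagonal-run (suc (length l)) q ◅◅ next-number ◅◅ run) ▻
   cong (λ r → config finish i (tapeFrom (word r) (nothing ∷ [])) c)
     (sym (trans (++-ʳ++ (numberEntry bs)) (++-ʳ++ (diagonalEntries (2 + length l) q)))))
  where
  slack : ∀ b k q N → 1 + (b + 5 + (7 * (2 + suc k + q) + 1 + (1 + (N + suc k * (7 * (2 + (k + suc q)) + 7)))))
                    ≡ b + suc N + (2 + k) * (7 * (2 + (suc k + q)) + 7)
  slack = solve-∀
  total : suc (length bs + 5 + (7 * (2 + suc (length l) + q) + 1 +
            (1 + (length (numbers l) + suc (length l) * rowCost (length l + suc q)))))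
       ≡ length (numbers (bs ∷ l)) + (2 + length l) * rowCost (suc (length l) + q)
  total = trans (slack (length bs) (length l) q (length (numbers l)))
    (cong (_+ (2 + length l) * rowCost (suc (length l) + q))
      (trans (cong (_+ suc (length (numbers l))) (sym (length-map bit bs))) (sym (length-++ (List.map bit bs)))))

-- Counting commas, rewinding, reading the output

commas : Word → ℕ
commas []          = 0
commas (comma ∷ w) = suc (commas w)
commas (_ ∷ w)     = commas w

commas-numbers : ∀ l → commas (numbers l) ≡ length l
commas-numbers []       = refl
commas-numbers (bs ∷ l) = commas-map-bit bs
  where
  commas-map-bit : ∀ bs → commas (List.map bit bs ++ comma ∷ numbers l) ≡ suc (length l)
  commas-map-bit []       = cong suc (commas-numbers l)
  commas-map-bit (_ ∷ bs) = commas-map-bit bs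

input-right : ∀ {q o c a u} w →
  config q (move right (tape (word u) (` a) (word w))) o c ≡ config q (tapeAt (word (a ∷ u)) (word w)) o c
input-right {q} {o} {c} {a} {u} w = cong (λ i → config q i o c) (move-right (word u) (` a) (word w))

count-run : ∀ {u o cs} w → config count (tapeAt (word u) (word w)) o (tape [] nothing cs) ⟶[ suc (length w) ]
  config rewind (tapeFrom (word (w ʳ++ u)) (nothing ∷ [])) o (tape [] nothing (replicate (suc (commas w)) c1 ++ cs))
count-run {u} {o} {cs} [] =
  refl ◅⟨ cong (λ i → config rewind i o (tape [] nothing (c1 ∷ cs))) (move-left (word u) nothing []) ⟩ done
count-run {u} {o} {cs} (comma ∷ w) =
  (refl ◅⟨ input-right w ⟩ count-run w) ▻
  cong (λ cs′ → config rewind (tapeFrom (word (w ʳ++ comma ∷ u)) (nothing ∷ [])) o (tape [] nothing cs′))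
    (replicate-∷ (suc (commas w)) c1 cs)
count-run (bit b     ∷ w) = refl ◅⟨ input-right w ⟩ count-run w
count-run (plus      ∷ w) = refl ◅⟨ input-right w ⟩ count-run w
count-run (minus     ∷ w) = refl ◅⟨ input-right w ⟩ count-run w
count-run (slash     ∷ w) = refl ◅⟨ input-right w ⟩ count-run w
count-run (semicolon ∷ w) = refl ◅⟨ input-right w ⟩ count-run w

rewind-run : ∀ {o c} u w → config rewind (tapeFrom (word u) (word w ++ nothing ∷ [])) o c ⟶[ suc (length u) ]
  config number (tapeAt (nothing ∷ []) (word (u ʳ++ w) ++ nothing ∷ [])) o c
rewind-run {o} {c} []      w = refl ◅⟨ cong (λ i → config number i o c) (move-right [] nothing _) ⟩ done
rewind-run {o} {c} (a ∷ u) w = refl ◅⟨ cong (λ i → config rewind i o c) (move-left (word u) (` a) _) ⟩ rewind-run u (a ∷ w)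

finish-run : ∀ {i c} u w → config finish i (tapeFrom (word u) (word w ++ nothing ∷ [])) c ⟶[ suc (length u) ]
  config halt i (tapeAt (nothing ∷ []) (word (u ʳ++ w) ++ nothing ∷ [])) c
finish-run {i} {c} []      w = refl ◅⟨ cong (λ o → config halt i o c) (move-right [] nothing _) ⟩ done
finish-run {i} {c} (a ∷ u) w = refl ◅⟨ cong (λ o → config finish i o c) (move-left (word u) (` a) _) ⟩ finish-run u (a ∷ w)

prefix : List (Cell 3) → Word
prefix (` a ∷ cs) = a ∷ prefix cs
prefix _          = []

-- The equations determine `f` by recursion on the cells, so a function without an accessible name
-- can be identified through them.
prefix-unique : (f : List (Cell 3) → Word) → f [] ≡ [] → (∀ cs → f (nothing ∷ cs) ≡ []) →
  (∀ b cs → f (aux b ∷ cs) ≡ []) → (∀ a cs → f (` a ∷ cs) ≡ a ∷ f cs) → ∀ cs → f cs ≡ prefix cs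
prefix-unique f e₀ e₁ e₂ e₃ []             = e₀
prefix-unique f e₀ e₁ e₂ e₃ (` a ∷ cs)     = trans (e₃ a cs) (cong (a ∷_) (prefix-unique f e₀ e₁ e₂ e₃ cs))
prefix-unique f e₀ e₁ e₂ e₃ (aux b ∷ cs)   = e₂ b cs
prefix-unique f e₀ e₁ e₂ e₃ (nothing ∷ cs) = e₁ cs

readWord-∷ : ∀ ls a cs → readWord (tape ls (` a) cs) ≡ a ∷ _
readWord-∷ ls a cs = refl

-- The local function of readWord has no name outside Defs, and it depends on
-- the whole tape, so it cannot be analysed by recursion on its argument.
-- Generalising over the tape lets unification recover it as scanner.
mutual
  scanner : Tape 3 → List (Cell 3) → Word
  scanner = _

  readWord-scanner : ∀ ls a cs → readWord (tape ls (` a) cs) ≡ a ∷ scanner (tape ls (` a) cs) cs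
  readWord-scanner ls a cs with tape ls (` a) cs | readWord-∷ ls a cs
  ... | t | e = e

readWord≡prefix : ∀ ls a cs → readWord (tape ls (` a) cs) ≡ a ∷ prefix cs
readWord≡prefix ls a cs = trans (readWord-scanner ls a cs)
  (cong (a ∷_) (prefix-unique (scanner (tape ls (` a) cs)) refl (λ _ → refl) (λ _ _ → refl) (λ _ _ → refl) cs))

prefix-word : ∀ w → prefix (word w ++ nothing ∷ []) ≡ w
prefix-word []      = refl
prefix-word (a ∷ w) = cong (a ∷_) (prefix-word w)

-- Each step moves the output head by at most one cell, so the time spent before
-- the final rewinding also bounds the duration of the rewinding.
outputLength : Configuration → ℕ
outputLength c = length (Tape.before (Vec.head (Vec.tail (Configuration.contents c))))

writeMove-length : ∀ t (a : Cell 3 × Direction) →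
  length (Tape.before (writeMove t a)) ≤ suc (length (Tape.before t))
writeMove-length (tape [] _ _)       (_ , left)  = z≤n
writeMove-length (tape (_ ∷ ls) _ _) (_ , left)  = m≤n+m (length ls) 2
writeMove-length (tape ls _ [])      (_ , right) = ≤-refl
writeMove-length (tape ls _ (_ ∷ _)) (_ , right) = ≤-refl
writeMove-length (tape ls _ _)       (_ , stay)  = n≤1+n _

next-length : ∀ {c c′} → next c ≡ just c′ → outputLength c′ ≤ suc (outputLength c)
next-length {configuration q (i ∷ o ∷ c ∷ [])} e
  with act q (Tape.scanned i) (Tape.scanned o) (Tape.scanned c)
next-length {configuration q (i ∷ o ∷ c ∷ [])} refl | just (_ , _ ∷ a ∷ _ ∷ []) = writeMove-length o a

outputLength-bound : ∀ {c c′ t} → c ⟶[ t ] c′ → outputLength c′ ≤ outputLength c + t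
outputLength-bound {c} {t = t} done = m≤m+n _ t
outputLength-bound {c} {c″} {suc t} (_◅_ {c′ = c′} e c⟶) = begin
  outputLength c″            ≤⟨ outputLength-bound c⟶ ⟩
  outputLength c′ + t        ≤⟨ +-monoˡ-≤ t (next-length {c} {c′} e) ⟩
  suc (outputLength c) + t   ≡⟨ +-suc (outputLength c) t ⟨
  outputLength c + suc t     ∎
  where open ≤-Reasoning

inputTape≡tapeAt : ∀ w → inputTape w ≡ tapeAt [] (word w)
inputTape≡tapeAt []      = refl
inputTape≡tapeAt (_ ∷ _) = refl

-- The complete run and its cost

header : Word
header = plus ∷ bit true ∷ slash ∷ bit true ∷ semicolon ∷ []

firstRow : List Bool → ℕ → Word
firstRow bs k = numberEntry bs ++ entries (2 + k) 1F ++ semicolon ∷ []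

result : List Bool → List (List Bool) → Word
result bs l = header ++ firstRow bs (length l) ++ rows l 0

-- The summands follow the phases: header, counting, rewinding, number and ones of the first row,
-- the step to the next number, the remaining rows.
cost : List Bool → List (List Bool) → ℕ
cost bs l = 5 + (suc L + (suc L + (length bs + 5 + (7 * (2 + k) + 1 + (1 + (length (numbers l) + suc k * rowCost (k + 0)))))))
  where
  L = length (numbers (bs ∷ l))
  k = length l

finish-reached : ∀ bs l → ∃ λ i → ∃ λ c →
  initial (numbers (bs ∷ l)) ⟶[ cost bs l ]
  config finish i (tapeFrom (word (List.reverse (result bs l))) (nothing ∷ [])) c
finish-reached bs l =
  let i , c , run = rows-run l 0
  in i , c ,
  ((write-header ◅◅ count-commas ◅◅ rewound ◅◅ number-run bs more ◅◅ ones-run (suc k) ◅◅ next-number ◅◅ run) ▻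
   cong (λ r → config finish i (tapeFrom (word r) (nothing ∷ [])) c) (sym written))
  where
  k = length l
  input = numbers (bs ∷ l)

  written : List.reverse (result bs l) ≡
    rows l 0 ʳ++ (entries (2 + k) 1F ++ semicolon ∷ []) ʳ++ numberEntry bs ʳ++ List.reverse header
  written = trans (++-ʳ++ (firstRow bs k)) (cong (rows l 0 ʳ++_) (++-ʳ++ (numberEntry bs)))

  write-header : initial input ⟶[ 5 ]
    config count (tapeAt [] (word input)) (out (List.reverse header)) (tape [] nothing (` semicolon ∷ []))
  write-header rewrite inputTape≡tapeAt input = refl ◅ refl ◅ refl ◅ refl ◅ refl ◅ done

  count-commas : ∀ {o cs} → config count (tapeAt [] (word input)) o (tape [] nothing cs) ⟶[ suc (length input) ]
    config rewind (tapeFrom (word (List.reverse input)) (nothing ∷ [])) o (tape [] nothing (replicate (2 + k) c1 ++ cs))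
  count-commas {o} {cs} = count-run input ▻
    cong (λ m → config rewind (tapeFrom (word (List.reverse input)) (nothing ∷ [])) o
                  (tape [] nothing (replicate (suc m) c1 ++ cs)))
      (commas-numbers (bs ∷ l))

  rewound : ∀ {o c} → config rewind (tapeFrom (word (List.reverse input)) (nothing ∷ [])) o c ⟶[ suc (length input) ]
    config number (tapeAt (nothing ∷ []) (word input ++ nothing ∷ [])) o c
  rewound {o} {c} =
    relax (s≤s (≤-reflexive (length-reverse input))) (rewind-run (List.reverse input) []) ▻
    cong (λ v → config number (tapeAt (nothing ∷ []) (word v ++ nothing ∷ [])) o c) (reverse-involutive input)

commas≤length : ∀ w → commas w ≤ length w
commas≤length []              = z≤n
commas≤length (comma     ∷ w) = s≤s (commas≤length w)
commas≤length (bit _     ∷ w) = m≤n⇒m≤1+n (commas≤length w)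
commas≤length (plus      ∷ w) = m≤n⇒m≤1+n (commas≤length w)
commas≤length (minus     ∷ w) = m≤n⇒m≤1+n (commas≤length w)
commas≤length (slash     ∷ w) = m≤n⇒m≤1+n (commas≤length w)
commas≤length (semicolon ∷ w) = m≤n⇒m≤1+n (commas≤length w)

tapeFrom-length : ∀ u rs → length u ≤ suc (length (Tape.before (tapeFrom (word u) rs)))
tapeFrom-length []      rs = z≤n
tapeFrom-length (_ ∷ u) rs = s≤s (≤-reflexive (sym (length-map `_ u)))

-- The second summand is for rewinding the output. As `cost` is at most 7L² + 24L + 21, the total is
-- at most 14L² + 48L + 44; then L ≤ L² gives 62L² + 44, and the constant is raised to 62 to match
-- the required form.
cost-bound : ∀ bs l → let L = length (numbers (bs ∷ l)) in
  cost bs l + suc (suc (cost bs l)) ≤ 62 * L ^ 2 + 62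
cost-bound bs l = begin
  cost bs l + suc (suc (cost bs l))  ≤⟨ +-mono-≤ cost≤ (s≤s (s≤s cost≤)) ⟩
  S + suc (suc S)                    ≡⟨ expand L ⟩
  48 * L + (14 * (L * L) + 44)       ≤⟨ +-monoˡ-≤ _ (*-monoʳ-≤ 48 L≤L²) ⟩
  48 * (L * L) + (14 * (L * L) + 44) ≤⟨ m≤m+n _ 18 ⟩
  48 * (L * L) + (14 * (L * L) + 44) + 18 ≡⟨ collect (L * L) ⟩
  62 * (L * L) + 62                  ≡⟨ cong (λ x → 62 * (L * x) + 62) (*-identityʳ L) ⟨
  62 * L ^ 2 + 62                    ∎
  where
  open ≤-Reasoning
  k = length l
  N = length (numbers l)
  L = length (numbers (bs ∷ l))
  S = 7 * (L * L) + 24 * L + 21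

  K≤L : suc k ≤ L
  K≤L = subst (_≤ L) (commas-numbers (bs ∷ l)) (commas≤length (numbers (bs ∷ l)))

  L≡ : L ≡ length bs + suc N
  L≡ = trans (length-++ (List.map bit bs)) (cong (_+ suc N) (length-map bit bs))

  L≤L² : L ≤ L * L
  L≤L² = m≤m*n L L {{>-nonZero (≤-trans (s≤s z≤n) K≤L)}}

  regroup : ∀ L b N k →
    5 + (suc L + (suc L + (b + 5 + (7 * (2 + k) + 1 + (1 + (N + suc k * (7 * (2 + (k + 0)) + 7))))))) + 1
    ≡ (b + suc N) + (7 * (suc k * suc k) + 21 * suc k + (2 * L + 21))
  regroup = solve-∀

  expand : ∀ L → 7 * (L * L) + 24 * L + 21 + suc (suc (7 * (L * L) + 24 * L + 21)) ≡ 48 * L + (14 * (L * L) + 44)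
  expand = solve-∀

  collect : ∀ x → 48 * x + (14 * x + 44) + 18 ≡ 62 * x + 62
  collect = solve-∀

  assemble : ∀ L → L + (7 * (L * L) + 21 * L + (2 * L + 21)) ≡ 7 * (L * L) + 24 * L + 21
  assemble = solve-∀

  cost≤ : cost bs l ≤ S
  cost≤ = begin
    cost bs l       ≤⟨ m≤m+n _ 1 ⟩
    cost bs l + 1   ≡⟨ regroup L (length bs) N k ⟩
    (length bs + suc N) + (7 * (suc k * suc k) + 21 * suc k + (2 * L + 21)) ≡⟨ cong (_+ (7 * (suc k * suc k) + 21 * suc k + (2 * L + 21))) L≡ ⟨
    L + (7 * (suc k * suc k) + 21 * suc k + (2 * L + 21))
      ≤⟨ +-monoʳ-≤ L (+-monoˡ-≤ _ (+-mono-≤ (*-monoʳ-≤ 7 (*-mono-≤ K≤L K≤L)) (*-monoʳ-≤ 21 K≤L))) ⟩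
    L + (7 * (L * L) + 21 * L + (2 * L + 21)) ≡⟨ assemble L ⟩
    S               ∎

machine-computes : ∀ bs l → let w = numbers (bs ∷ l) in
  Computes w ↦ result bs l within (62 * length w ^ 2 + 62)
machine-computes bs l =
  let i , c , run = finish-reached bs l
      u = List.reverse (result bs l)
      u≤ = ≤-trans (tapeFrom-length u (nothing ∷ [])) (s≤s (outputLength-bound run))
      full = relax (≤-trans (+-monoʳ-≤ (cost bs l) (s≤s u≤)) (cost-bound bs l)) (run ◅◅ finish-run u []) ▻
        cong (λ v → config halt i (tapeAt (nothing ∷ []) (word v ++ nothing ∷ [])) c) (reverse-involutive (result bs l))
  in subst (λ d → Halted d × output d ≡ result bs l) (sym (run-reaches full refl))
       -- The result starts with the `plus` of the header, so the head is on a symbol.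
       (refl , trans (readWord≡prefix (nothing ∷ []) plus _) (cong (plus ∷_) (prefix-word (List.drop 1 (result bs l)))))

-- The lattice

snoc : ∀ {A : Set} {n} → Vector A n → A → Vector A (suc n)
snoc {n = zero}  v x _       = x
snoc {n = suc n} v x zero    = v zero
snoc {n = suc n} v x (suc i) = snoc (Vector.tail v) x i

snoc-inject₁ : ∀ {A : Set} {n} (v : Vector A n) x i → snoc v x (inject₁ i) ≡ v i
snoc-inject₁ v x zero    = refl
snoc-inject₁ v x (suc i) = snoc-inject₁ (Vector.tail v) x i

snoc-fromℕ : ∀ {A : Set} n (v : Vector A n) x → snoc v x (fromℕ n) ≡ x
snoc-fromℕ zero    v x = refl
snoc-fromℕ (suc n) v x = snoc-fromℕ n (Vector.tail v) x

snoc-elim : ∀ {A : Set} (P : A → Set) {n} {v : Vector A n} {x} → (∀ i → P (v i)) → P x → ∀ i → P (snoc v x i)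
snoc-elim P {zero}  pv px i       = px
snoc-elim P {suc n} pv px zero    = pv zero
snoc-elim P {suc n} pv px (suc i) = snoc-elim P (λ j → pv (suc j)) px i

-- The unit vector of the added place is 0 wherever the weight need not be. This makes the first
-- coordinate of the vector of norm 2 vanish.
snoc-orthogonal : ∀ {n} (a : Vector ℕ n) i → snoc (λ _ → 0ℤ) 1ℤ i ℤ.* + snoc a 0 i ≡ 0ℤ
snoc-orthogonal {zero}  a i       = refl
snoc-orthogonal {suc n} a zero    = refl
snoc-orthogonal {suc n} a (suc i) = snoc-orthogonal (Vector.tail a) i

-- The single 2 of the n columns has q columns to its right; there is none if n ≤ q.
mark : ℕ → ∀ n → Vector ℕ n
mark q (suc n) zero    = if does (n ℕₚ.≟ q) then 2 else 0
mark q (suc n) (suc j) = mark q n j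

mark-head-≡ : ∀ q → mark q (suc q) zero ≡ 2
mark-head-≡ q = cong (λ b → if b then 2 else 0) (dec-true (q ℕₚ.≟ q) refl)

mark-head-≢ : ∀ {q n} → n ≢ q → mark q (suc n) zero ≡ 0
mark-head-≢ {q} {n} n≢q = cong (λ b → if b then 2 else 0) (dec-false (n ℕₚ.≟ q) n≢q)

-- `opposite` counts columns from the right, so row `i` has its 2 in column `opposite i`.
mark-≡ : ∀ n (j : Fin n) → mark (toℕ (opposite j)) n j ≡ 2
mark-≡ (suc n) zero    = trans (cong (λ q → mark q (suc n) zero) (toℕ-fromℕ n)) (mark-head-≡ n)
mark-≡ (suc n) (suc j) = trans (cong (λ q → mark q n j) (toℕ-inject₁ (opposite j))) (mark-≡ n j)

mark-≢ : ∀ {q} n (j : Fin n) → toℕ (opposite j) ≢ q → mark q n j ≡ 0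
mark-≢ (suc n) zero    j≢q = mark-head-≢ (λ e → j≢q (trans (toℕ-fromℕ n) e))
mark-≢ (suc n) (suc j) j≢q = mark-≢ n j (λ e → j≢q (trans (toℕ-inject₁ (opposite j)) e))

-- Column 0 is the doubled weight, column 1 the homogenising coordinate.
row : ∀ m → ℕ → ℕ → Vector ℤ (2 + m)
row m w q zero    = + (2 * w)
row m w q (suc j) = + mark q (suc m) j

matrix : ∀ {m} → ℕ → Vector ℕ m → Vector (Vector ℤ (2 + m)) (suc m)
matrix     s w zero    zero    = + (2 * s)
matrix     s w zero    (suc j) = + 1
matrix {m} s w (suc i) j       = row m (w i) (toℕ i) j

-- Integers among the rationals

fromℤ-+ : ∀ i j → fromℤ (i ℤ.+ j) ≡ fromℤ i ℚ.+ fromℤ j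
fromℤ-+ i j = ℚₚ.toℚᵘ-injective (ℚᵘₚ.≃-trans (ℚᵘ.*≡* (cong (ℤ._* + 1) (cong₂ ℤ._+_ (sym (ℤₚ.*-identityʳ i)) (sym (ℤₚ.*-identityʳ j)))))
  (ℚᵘₚ.≃-sym (ℚₚ.toℚᵘ-homo-+ (fromℤ i) (fromℤ j))))

fromℤ-* : ∀ i j → fromℤ (i ℤ.* j) ≡ fromℤ i ℚ.* fromℤ j
fromℤ-* i j = ℚₚ.toℚᵘ-injective (ℚᵘₚ.≃-trans (ℚᵘ.*≡* refl)
  (ℚᵘₚ.≃-sym (ℚₚ.toℚᵘ-homo-* (fromℤ i) (fromℤ j))))

fromℤ-mono-≤ : ∀ {i j} → i ℤ.≤ j → fromℤ i ℚ.≤ fromℤ j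
fromℤ-mono-≤ i≤j = *≤* (subst₂ ℤ._≤_ (sym (ℤₚ.*-identityʳ _)) (sym (ℤₚ.*-identityʳ _)) i≤j)

∑-fromℤ : ∀ {n} {f : Vector ℚ n} (g : Vector ℤ n) → (∀ i → f i ≡ fromℤ (g i)) → ∑ℚ f ≡ fromℤ (∑ℤ g)
∑-fromℤ {zero}  g e = refl
∑-fromℤ {suc n} g e = trans (cong₂ ℚ._+_ (e zero) (∑-fromℤ (Vector.tail g) (λ i → e (suc i)))) (sym (fromℤ-+ (g zero) _))

∑ℚ-zero : ∀ {n} {f : Vector ℚ n} → (∀ i → f i ≡ 0ℚ) → ∑ℚ f ≡ 0ℚ
∑ℚ-zero {zero}  e = refl
∑ℚ-zero {suc n} e = cong₂ ℚ._+_ (e zero) (∑ℚ-zero (λ i → e (suc i)))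

∑ℤ-zero : ∀ {n} {f : Vector ℤ n} → (∀ i → f i ≡ 0ℤ) → ∑ℤ f ≡ 0ℤ
∑ℤ-zero {zero}  e = refl
∑ℤ-zero {suc n} e = cong₂ ℤ._+_ (e zero) (∑ℤ-zero (λ i → e (suc i)))

∑ℚ-single : ∀ {n} {f : Vector ℚ n} k → (∀ i → k ≢ i → f i ≡ 0ℚ) → ∑ℚ f ≡ f k
∑ℚ-single {f = f} zero    e = trans (cong (λ x → f zero ℚ.+ x) (∑ℚ-zero (λ i → e (suc i) λ ()))) (ℚₚ.+-identityʳ _)
∑ℚ-single (suc k) e = trans (cong₂ ℚ._+_ (e zero λ ()) (∑ℚ-single k (λ i k≢i → e (suc i) λ { refl → k≢i refl }))) (ℚₚ.+-identityˡ _)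

-- Independence and integer coordinates

2ℚ : ℚ
2ℚ = fromℤ (+ 2)

module _ {m} (s : ℕ) (w : Vector ℕ m) where

  basisOf : Vector (Vector ℚ (2 + m)) (suc m)
  basisOf i j = fromℤ (matrix s w i j)

  -- This column has m columns to its right and every row index is below m, so no 2 falls into it.
  column₁ : (c : Vector ℚ (suc m)) → ∑ℚ (λ i → c i ℚ.* basisOf i 1F) ≡ c zero
  column₁ c = trans (cong₂ ℚ._+_ (ℚₚ.*-identityʳ (c zero)) (∑ℚ-zero λ i →
      trans (cong (λ x → c (suc i) ℚ.* fromℤ (+ x)) (mark-head-≢ (λ e → ℕₚ.<⇒≢ (toℕ<n i) (sym e)))) (ℚₚ.*-zeroʳ (c (suc i)))))
    (ℚₚ.+-identityʳ (c zero))

  column : (c : Vector ℚ (suc m)) → ∀ j →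
    ∑ℚ (λ i → c i ℚ.* basisOf i (suc (suc j))) ≡ c zero ℚ.+ c (suc (opposite j)) ℚ.* 2ℚ
  column c j = cong₂ ℚ._+_ (ℚₚ.*-identityʳ (c zero))
    (trans (∑ℚ-single (opposite j) λ i j≢i →
        trans (cong (λ x → c (suc i) ℚ.* fromℤ (+ x)) (mark-≢ m j (λ e → j≢i (toℕ-injective e)))) (ℚₚ.*-zeroʳ (c (suc i))))
      (cong (λ x → c (suc (opposite j)) ℚ.* fromℤ (+ x)) (mark-≡ m j)))

  -- The homogenising column isolates the first coefficient; once that is 0, each later column
  -- equates twice one coefficient with 0, and `opposite` reaches them all.
  basisOf-independent : LinearlyIndependent basisOf
  basisOf-independent c e = λ { zero → c₀≡0 ; (suc i) → cᵢ≡0 i }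
    where
    c₀≡0 : c zero ≡ 0ℚ
    c₀≡0 = trans (sym (column₁ c)) (e 1F)
    opposite≡0 : ∀ j → c (suc (opposite j)) ≡ 0ℚ
    opposite≡0 j = begin
      x                        ≡⟨ ℚₚ.*-identityʳ x ⟨
      x ℚ.* (2ℚ ℚ.* ℚ.½)       ≡⟨ ℚₚ.*-assoc x 2ℚ ℚ.½ ⟨
      x ℚ.* 2ℚ ℚ.* ℚ.½         ≡⟨ cong (ℚ._* ℚ.½) (ℚₚ.+-identityˡ (x ℚ.* 2ℚ)) ⟨
      (0ℚ ℚ.+ x ℚ.* 2ℚ) ℚ.* ℚ.½ ≡⟨ cong (λ y → (y ℚ.+ x ℚ.* 2ℚ) ℚ.* ℚ.½) c₀≡0 ⟨
      (c zero ℚ.+ x ℚ.* 2ℚ) ℚ.* ℚ.½ ≡⟨ cong (ℚ._* ℚ.½) (trans (sym (column c j)) (e (suc (suc j)))) ⟩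
      0ℚ                       ∎
      where
      open ≡-Reasoning
      x = c (suc (opposite j))
    cᵢ≡0 : ∀ i → c (suc i) ≡ 0ℚ
    cᵢ≡0 i = subst (λ k → c (suc k) ≡ 0ℚ) (opposite-involutive i) (opposite≡0 (opposite i))

  -- The lattice vector over the integers, where absolute values are natural numbers and bounds on
  -- them are decidable.
  coords : Vector ℤ (suc m) → Vector ℤ (2 + m)
  coords z zero          = + 2 ℤ.* (z zero ℤ.* + s ℤ.+ ∑ℤ (λ i → z (suc i) ℤ.* + w i))
  coords z (suc zero)    = z zero
  coords z (suc (suc j)) = z zero ℤ.+ z (suc (opposite j)) ℤ.* + 2

  coords-correct : ∀ z j → ∑ℚ (λ i → fromℤ (z i) ℚ.* basisOf i j) ≡ fromℤ (coords z j)
  coords-correct z zero = trans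
    (∑-fromℤ (λ i → + 2 ℤ.* (z i ℤ.* weight i)) λ i → trans (sym (fromℤ-* (z i) _)) (cong fromℤ (entry≡ i)))
    (cong fromℤ (∑ℤ-double (λ i → z i ℤ.* weight i)))
    where
    weight : Vector ℤ (suc m)
    weight zero    = + s
    weight (suc i) = + w i
    swap : ∀ x n → x ℤ.* + (2 * n) ≡ + 2 ℤ.* (x ℤ.* + n)
    swap x n = trans (cong (x ℤ.*_) (ℤₚ.pos-* 2 n))
      (trans (sym (ℤₚ.*-assoc x (+ 2) (+ n))) (trans (cong (ℤ._* + n) (ℤₚ.*-comm x (+ 2))) (ℤₚ.*-assoc (+ 2) x (+ n))))
    entry≡ : ∀ i → z i ℤ.* matrix s w i zero ≡ + 2 ℤ.* (z i ℤ.* weight i)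
    entry≡ zero    = swap (z zero) s
    entry≡ (suc i) = swap (z (suc i)) (w i)
    ∑ℤ-double : ∀ {n} (f : Vector ℤ n) → ∑ℤ (λ i → + 2 ℤ.* f i) ≡ + 2 ℤ.* ∑ℤ f
    ∑ℤ-double {zero}  f = refl
    ∑ℤ-double {suc n} f = trans (cong (λ t → + 2 ℤ.* f zero ℤ.+ t) (∑ℤ-double (Vector.tail f))) (sym (ℤₚ.*-distribˡ-+ (+ 2) (f zero) _))
  coords-correct z (suc zero) = column₁ (λ i → fromℤ (z i))
  coords-correct z (suc (suc j)) = trans (column (λ i → fromℤ (z i)) j)
    (trans (cong (fromℤ (z zero) ℚ.+_) (sym (fromℤ-* (z (suc (opposite j))) (+ 2)))) (sym (fromℤ-+ (z zero) _)))

-- The maximum norm of integral vectors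

norm-≥ : ∀ {n} (v : Vector ℚ n) j → ∣ v j ∣ ℚ.≤ ‖ v ‖∞
norm-≥ v zero    = ℚₚ.p≤p⊔q _ _
norm-≥ v (suc j) = ℚₚ.≤-trans (norm-≥ (Vector.tail v) j) (ℚₚ.p≤q⊔p ∣ v zero ∣ _)

norm-≤ : ∀ {n} (v : Vector ℚ n) {r} → 0ℚ ℚ.≤ r → (∀ j → ∣ v j ∣ ℚ.≤ r) → ‖ v ‖∞ ℚ.≤ r
norm-≤ {zero}  v 0≤r v≤r = 0≤r
norm-≤ {suc n} v 0≤r v≤r = ℚₚ.⊔-lub (v≤r zero) (norm-≤ (Vector.tail v) 0≤r (λ j → v≤r (suc j)))

module _ {n} {v : Vector ℚ n} {y : Vector ℤ n} (v≡y : ∀ j → v j ≡ fromℤ (y j)) where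

  integral-norm-≤ : ∀ k → (∀ j → ℤ.∣ y j ∣ ≤ k) → ‖ v ‖∞ ℚ.≤ fromℤ (+ k)
  integral-norm-≤ k y≤k = norm-≤ v (fromℤ-mono-≤ (ℤ.+≤+ z≤n)) λ j →
    subst (λ x → ∣ x ∣ ℚ.≤ fromℤ (+ k)) (sym (v≡y j)) (fromℤ-mono-≤ (ℤ.+≤+ (y≤k j)))

  -- Decidability turns the failure of the bound into a coordinate violating it, and integrality
  -- makes that one at least `suc k`.
  integral-norm-> : ∀ k → ¬ (∀ j → ℤ.∣ y j ∣ ≤ k) → fromℤ (+ suc k) ℚ.≤ ‖ v ‖∞
  integral-norm-> k y≰k with j , yj≰k ← ¬∀⟶∃¬ n _ (λ j → ℤ.∣ y j ∣ ℕₚ.≤? k) y≰k =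
    ℚₚ.≤-trans
      (subst (λ x → fromℤ (+ suc k) ℚ.≤ ∣ x ∣) (sym (v≡y j)) (fromℤ-mono-≤ (ℤ.+≤+ (ℕₚ.≰⇒> yj≰k))))
      (norm-≥ v j)

  integral-norm-≥1 : NonZeroVector v → 1ℚ ℚ.≤ ‖ v ‖∞
  integral-norm-≥1 v≢0 = integral-norm-> 0 λ y≤0 → v≢0 λ j →
    trans (v≡y j) (cong fromℤ (ℤₚ.∣i∣≡0⇒i≡0 (ℕₚ.n≤0⇒n≡0 (y≤0 j))))

-- Short vectors and subset sums

-- 2|y| ≤ |x + 2y| + |x| ≤ 2.
half-bound : ∀ x y → ℤ.∣ x ∣ ≤ 1 → ℤ.∣ x ℤ.+ y ℤ.* + 2 ∣ ≤ 1 → ℤ.∣ y ∣ ≤ 1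
half-bound x y x≤1 x+2y≤1 = ℕₚ.*-cancelʳ-≤ ℤ.∣ y ∣ 1 2 (begin
  ℤ.∣ y ∣ * 2                            ≡⟨ ℤₚ.abs-* y (+ 2) ⟨
  ℤ.∣ y ℤ.* + 2 ∣                        ≡⟨ cong ℤ.∣_∣ (cancel x (y ℤ.* + 2)) ⟨
  ℤ.∣ x ℤ.+ y ℤ.* + 2 ℤ.- x ∣            ≤⟨ ℤₚ.∣i-j∣≤∣i∣+∣j∣ (x ℤ.+ y ℤ.* + 2) x ⟩
  ℤ.∣ x ℤ.+ y ℤ.* + 2 ∣ + ℤ.∣ x ∣        ≤⟨ ℕₚ.+-mono-≤ x+2y≤1 x≤1 ⟩
  2                                      ∎)
  where
  open ℕₚ.≤-Reasoning
  cancel : ∀ x t → x ℤ.+ t ℤ.- x ≡ t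
  cancel x t = trans (cong (ℤ._- x) (ℤₚ.+-comm x t)) (trans (ℤₚ.+-assoc t x (ℤ.- x)) (trans (cong (λ u → t ℤ.+ u) (ℤₚ.+-inverseʳ x)) (ℤₚ.+-identityʳ t)))

data Small : ℤ → Set where
  is0  : Small (+ 0)
  is+1 : Small (+ 1)
  is-1 : Small -[1+ 0 ]

small : ∀ {x} → ℤ.∣ x ∣ ≤ 1 → Small x
small {+ 0}           _        = is0
small {+ 1}           _        = is+1
small {+ suc (suc _)} (s≤s ())
small { -[1+ 0 ]}     _        = is-1
small { -[1+ suc _ ]} (s≤s ())

zero-digit : ∀ y → ℤ.∣ 0ℤ ℤ.+ y ℤ.* + 2 ∣ ≤ 1 → y ≡ 0ℤ
zero-digit y h with small {y} (half-bound 0ℤ y z≤n h)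
... | is0 = refl
zero-digit _ (s≤s ()) | is+1
zero-digit _ (s≤s ()) | is-1

data Unit : ℤ → Set where
  pos : Unit (+ 1)
  neg : Unit -[1+ 0 ]

-- Here σ is -z₀. For σ = 1 the bound |2y - 1| ≤ 1 excludes y = -1; σ = -1 is the mirror image.
binary-digit : ∀ {σ} → Unit σ → ∀ y → ℤ.∣ ℤ.- σ ℤ.+ y ℤ.* + 2 ∣ ≤ 1 → ∃ λ (x : Fin 2) → y ≡ σ ℤ.* + toℕ x
binary-digit pos y h with small {y} (half-bound -[1+ 0 ] y (s≤s z≤n) h)
... | is0  = 0F , refl
... | is+1 = 1F , refl
binary-digit pos _ (s≤s ()) | is-1
binary-digit neg y h with small {y} (half-bound (+ 1) y (s≤s z≤n) h)
... | is0  = 0F , refl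
... | is-1 = 1F , refl
binary-digit neg _ (s≤s ()) | is+1

∑-digits : ∀ {n} σ (w x : Vector ℕ n) {z : Vector ℤ n} → (∀ i → z i ≡ σ ℤ.* + x i) →
  ∑ℤ (λ i → z i ℤ.* + w i) ≡ σ ℤ.* + ∑ℕ (λ i → w i * x i)
∑-digits {zero}  σ w x e = sym (ℤₚ.*-zeroʳ σ)
∑-digits {suc n} σ w x {z} e = begin
  z zero ℤ.* + w zero ℤ.+ _                     ≡⟨ cong₂ (λ a b → a ℤ.* + w zero ℤ.+ b) (e zero) (∑-digits σ (Vector.tail w) (Vector.tail x) (λ i → e (suc i))) ⟩
  σ ℤ.* + x zero ℤ.* + w zero ℤ.+ σ ℤ.* + ∑     ≡⟨ cong (ℤ._+ σ ℤ.* + ∑) (trans (ℤₚ.*-assoc σ _ _) (cong (σ ℤ.*_) (trans (ℤₚ.*-comm (+ x zero) _) (sym (ℤₚ.pos-* (w zero) (x zero)))))) ⟩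
  σ ℤ.* + (w zero * x zero) ℤ.+ σ ℤ.* + ∑       ≡⟨ ℤₚ.*-distribˡ-+ σ (+ (w zero * x zero)) (+ ∑) ⟨
  σ ℤ.* + (w zero * x zero + ∑)                 ∎
  where
  open ≡-Reasoning
  ∑ = ∑ℕ (λ i → w (suc i) * x (suc i))

module _ {m} (s : ℕ) (w : Vector ℕ m) where

  SubsetSum : Set
  SubsetSum = Σ (Vector (Fin 2) m) λ x → ∑ℕ (λ i → w i * toℕ (x i)) ≡ s

  -- Serves both directions: σ = 1 for the vector built from a solution, either sign for reading a
  -- solution off a short vector.
  weight-coordinate : ∀ σ (x : Vector ℕ m) z → z zero ≡ ℤ.- σ → (∀ i → z (suc i) ≡ σ ℤ.* + x i) →
    coords s w z zero ≡ + 2 ℤ.* (σ ℤ.* (+ ∑ℕ (λ i → w i * x i) ℤ.- + s))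
  weight-coordinate σ x z z₀ zᵢ = cong (+ 2 ℤ.*_) (begin
    z zero ℤ.* + s ℤ.+ ∑ℤ (λ i → z (suc i) ℤ.* + w i) ≡⟨ cong₂ (λ a b → a ℤ.* + s ℤ.+ b) z₀ (∑-digits σ w x zᵢ) ⟩
    ℤ.- σ ℤ.* + s ℤ.+ σ ℤ.* + ∑                       ≡⟨ ℤₚ.+-comm _ (σ ℤ.* + ∑) ⟩
    σ ℤ.* + ∑ ℤ.+ ℤ.- σ ℤ.* + s                       ≡⟨ cong (λ t → σ ℤ.* + ∑ ℤ.+ t) (trans (sym (ℤₚ.neg-distribˡ-* σ (+ s))) (ℤₚ.neg-distribʳ-* σ (+ s))) ⟩
    σ ℤ.* + ∑ ℤ.+ σ ℤ.* ℤ.- + s                       ≡⟨ ℤₚ.*-distribˡ-+ σ (+ ∑) (ℤ.- + s) ⟨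
    σ ℤ.* (+ ∑ ℤ.- + s)                               ∎)
    where
    open ≡-Reasoning
    ∑ = ∑ℕ (λ i → w i * x i)

  -- The first coordinate has absolute value 2|∑ - s|. Thanks to the factor 2, a bound of 1 forces
  -- equality.
  extract : ∀ {σ} → Unit σ → ∀ z → z zero ≡ ℤ.- σ → (∀ j → ℤ.∣ coords s w z j ∣ ≤ 1) → SubsetSum
  extract {σ} u z z₀ y≤1 = x , sum≡s
    where
    digit : ∀ i → ∃ λ (x : Fin 2) → z (suc i) ≡ σ ℤ.* + toℕ x
    digit i = binary-digit u (z (suc i))
      (subst₂ (λ a k → ℤ.∣ a ℤ.+ z (suc k) ℤ.* + 2 ∣ ≤ 1) z₀ (opposite-involutive i) (y≤1 (suc (suc (opposite i)))))
    x : Vector (Fin 2) m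
    x i = proj₁ (digit i)
    ∑ = ∑ℕ (λ i → w i * toℕ (x i))
    abs-unit : ∀ {σ} → Unit σ → ∀ t → ℤ.∣ σ ℤ.* t ∣ ≡ ℤ.∣ t ∣
    abs-unit pos t = cong ℤ.∣_∣ (ℤₚ.*-identityˡ t)
    abs-unit neg t = trans (ℤₚ.abs-* -[1+ 0 ] t) (ℕₚ.*-identityˡ ℤ.∣ t ∣)
    bound : 2 * ℤ.∣ + ∑ ℤ.- + s ∣ ≤ 1
    bound = subst (_≤ 1)
      (trans (cong ℤ.∣_∣ (weight-coordinate σ (λ i → toℕ (x i)) z z₀ (λ i → proj₂ (digit i))))
        (trans (ℤₚ.abs-* (+ 2) (σ ℤ.* (+ ∑ ℤ.- + s))) (cong (2 *_) (abs-unit u (+ ∑ ℤ.- + s)))))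
      (y≤1 zero)
    vanish : ∀ n → 2 * n ≤ 1 → n ≡ 0
    vanish zero    _       = refl
    vanish (suc n) (s≤s h) = contradiction (ℕₚ.≤-trans (ℕₚ.m≤n+m (suc (n + 0)) n) h) λ ()
    sum≡s : ∑ ≡ s
    sum≡s = ℤₚ.+-injective (ℤₚ.i-j≡0⇒i≡j (+ ∑) (+ s) (ℤₚ.∣i∣≡0⇒i≡0 (vanish _ bound)))

  -- z₀ = ±1 would give a solution through `extract` with σ = -z₀; z₀ = 0 leaves coordinates 2zᵢ,
  -- which are too large unless zᵢ = 0.
  short⇒zero : ∀ z → (∀ j → ℤ.∣ coords s w z j ∣ ≤ 1) → ¬ SubsetSum → ∀ i → z i ≡ 0ℤ
  short⇒zero z y≤1 ∄x with z zero in z₀ | small {z zero} (y≤1 1F)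
  ... | _ | is+1 = contradiction (extract neg z z₀ y≤1) ∄x
  ... | _ | is-1 = contradiction (extract pos z z₀ y≤1) ∄x
  ... | _ | is0 = λ { zero → z₀ ; (suc i) → zero-digit (z (suc i))
      (subst₂ (λ a k → ℤ.∣ a ℤ.+ z (suc k) ℤ.* + 2 ∣ ≤ 1) z₀ (opposite-involutive i) (y≤1 (suc (suc (opposite i))))) }

-- The minimum of the lattice

latticeOf : ∀ {m} → ℕ → Vector ℕ m → Lattice
latticeOf s w = record { basis = basisOf s w ; independent = basisOf-independent s w }

module _ {m} (s : ℕ) (w : Vector ℕ m) where
  open Lattice (latticeOf s w) using (_∈ᴸ)

  combination : Vector ℤ (suc m) → Vector ℚ (2 + m)
  combination z j = ∑ℚ (λ i → fromℤ (z i) ℚ.* basisOf s w i j)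

  lattice-integral : ∀ {v} ((z , _) : v ∈ᴸ) → ∀ j → v j ≡ fromℤ (coords s w z j)
  lattice-integral (z , v≡) j = trans (v≡ j) (coords-correct s w z j)

  λ₁≡1 : SubsetSum s w → λ₁∞ latticeOf s w ≈ 1ℚ
  λ₁≡1 (x , ∑≡s) =
    (combination z , member , nonzero , ℚₚ.≤-antisym
      (integral-norm-≤ (lattice-integral member) 1 short)
      (integral-norm-≥1 (lattice-integral member) nonzero)) ,
    λ v v∈ v≢0 → integral-norm-≥1 (lattice-integral v∈) v≢0
    where
    z : Vector ℤ (suc m)
    z zero    = -[1+ 0 ]
    z (suc i) = + toℕ (x i)
    member : combination z ∈ᴸ
    member = z , λ _ → refl
    -- The homogenising coordinate is -1.
    nonzero : NonZeroVector (combination z)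
    nonzero v≡0 with () ← trans (sym (lattice-integral member 1F)) (v≡0 1F)
    digit-short : ∀ (d : Fin 2) → ℤ.∣ -[1+ 0 ] ℤ.+ + toℕ d ℤ.* + 2 ∣ ≤ 1
    digit-short 0F = s≤s z≤n
    digit-short 1F = s≤s z≤n
    short : ∀ j → ℤ.∣ coords s w z j ∣ ≤ 1
    short zero rewrite weight-coordinate s w (+ 1) (λ i → toℕ (x i)) z refl (λ i → sym (ℤₚ.*-identityˡ (z (suc i))))
      | ∑≡s | ℤₚ.+-inverseʳ (+ s) = z≤n
    short (suc zero)    = s≤s z≤n
    short (suc (suc j)) = digit-short (x (opposite j))

  nonSubsetSum-norm-≥2 : ¬ SubsetSum s w → ∀ v → v ∈ᴸ → NonZeroVector v → 2ℚ ℚ.≤ ‖ v ‖∞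
  nonSubsetSum-norm-≥2 ∄x v v∈@(z , v≡) v≢0 = integral-norm-> (lattice-integral v∈) 1 λ y≤1 → v≢0 λ j →
    trans (v≡ j) (∑ℚ-zero λ i →
      trans (cong (λ c → fromℤ c ℚ.* basisOf s w i j) (short⇒zero s w z y≤1 ∄x i)) (ℚₚ.*-zeroˡ (basisOf s w i j)))

∑-snoc : ∀ {n} (a : Vector ℕ n) (x : Vector ℕ (suc n)) →
  ∑ℕ (λ i → snoc a 0 i * x i) ≡ ∑ℕ (λ i → a i * x (inject₁ i))
∑-snoc {n} a x = begin
  ∑ℕ (λ i → snoc a 0 i * x i)
    ≡⟨ ∑ℕ-init-last (λ i → snoc a 0 i * x i) ⟩
  ∑ℕ (λ i → snoc a 0 (inject₁ i) * x (inject₁ i)) + snoc a 0 (fromℕ n) * x (fromℕ n)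
    ≡⟨ cong₂ _+_ (∑ℕ-cong (λ i → cong (_* x (inject₁ i)) (snoc-inject₁ a 0 i))) (cong (_* x (fromℕ n)) (snoc-fromℕ n a 0)) ⟩
  ∑ℕ (λ i → a i * x (inject₁ i)) + 0
    ≡⟨ ℕₚ.+-identityʳ _ ⟩
  ∑ℕ (λ i → a i * x (inject₁ i)) ∎
  where open ≡-Reasoning

module _ {n} (s : ℕ) (a : Vector ℕ n) where

  subsetSum-snoc : SubsetSum s a → SubsetSum s (snoc a 0)
  subsetSum-snoc (x , e) = snoc x 0F , trans (∑-snoc a (λ i → toℕ (snoc x 0F i)))
    (trans (∑ℕ-cong (λ i → cong (λ d → a i * toℕ d) (snoc-inject₁ x 0F i))) e)

  subsetSum-unsnoc : SubsetSum s (snoc a 0) → SubsetSum s a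
  subsetSum-unsnoc (x , e) = (λ i → x (inject₁ i)) , trans (sym (∑-snoc a (λ i → toℕ (x i)))) e

  -- NO-instances must exhibit a minimal vector as well. The basis vector of the added weight 0
  -- serves: its only nonzero coordinate is 2.
  λ₁≡2 : ¬ SubsetSum s a → λ₁∞ latticeOf s (snoc a 0) ≈ 2ℚ
  λ₁≡2 ∄x = (v , member , nonzero , ℚₚ.≤-antisym (integral-norm-≤ integral 2 short) (≥2 v member nonzero)) , ≥2
    where
    weights = snoc a 0
    ≥2 = nonSubsetSum-norm-≥2 s weights (λ x → ∄x (subsetSum-unsnoc x))
    z : Vector ℤ (2 + n)
    z zero    = 0ℤ
    z (suc i) = snoc (λ _ → 0ℤ) 1ℤ i
    v = combination s weights z
    member : Lattice._∈ᴸ (latticeOf s weights) v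
    member = z , λ _ → refl
    integral = lattice-integral s weights member
    nonzero : NonZeroVector v
    -- By the reversal, column `2F` carries the coefficient of the last weight.
    nonzero v≡0 with () ← trans (cong (λ t → fromℤ (0ℤ ℤ.+ t ℤ.* + 2)) (sym (snoc-fromℕ n (λ _ → 0ℤ) 1ℤ)))
      (trans (sym (integral 2F)) (v≡0 2F))
    weight≡0 : ∑ℤ (λ i → z (suc i) ℤ.* + weights i) ≡ 0ℤ
    weight≡0 = ∑ℤ-zero (snoc-orthogonal a)
    digit-short : ∀ i → ℤ.∣ 0ℤ ℤ.+ z (suc i) ℤ.* + 2 ∣ ≤ 2
    digit-short = snoc-elim (λ t → ℤ.∣ 0ℤ ℤ.+ t ℤ.* + 2 ∣ ≤ 2) (λ _ → z≤n) ℕₚ.≤-refl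
    short : ∀ j → ℤ.∣ coords s weights z j ∣ ≤ 2
    short zero rewrite weight≡0 = z≤n
    short (suc zero)    = z≤n
    short (suc (suc j)) = digit-short (opposite j)

-- Encodings

-- The first increment sets the low bit, the second clears it and carries into the rest.
increment-doubled : ∀ bs → increment (increment (doubled bs)) ≡ doubled (increment bs)
increment-doubled []           = refl
increment-doubled (false ∷ bs) = refl
increment-doubled (true ∷ bs)  = refl

bits-double : ∀ n → bits (2 * n) ≡ doubled (bits n)
bits-double zero    = refl
bits-double (suc n) rewrite ℕₚ.+-suc n (n + 0) =
  trans (cong (λ bs → increment (increment bs)) (bits-double n)) (increment-doubled (bits n))

encodeEntry : ℤ → Word
encodeEntry x = encodeℚ (fromℤ x) ++ comma ∷ []

encodeRow : ∀ {n} → Vector ℤ n → Word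
encodeRow v = encodeVector encodeℚ comma (λ j → fromℤ (v j)) ++ semicolon ∷ []

encodeEntry-double : ∀ n → encodeEntry (+ (2 * n)) ≡ numberEntry (bits n)
encodeEntry-double n = cong (plus ∷_) (trans (++-assoc (encodeℕ (2 * n)) _ _)
  (cong (λ bs → List.map bit bs ++ unitSuffix) (bits-double n)))

concat-tabulate-replicate : ∀ {A : Set} k {u : List A} {f : Vector (List A) k} → (∀ j → f j ≡ u) →
  concat (Vector.toList f) ≡ concat (replicate k u)
concat-tabulate-replicate zero    e = refl
concat-tabulate-replicate (suc k) e = cong₂ _++_ (e zero) (concat-tabulate-replicate k (λ j → e (suc j)))

encodeMark-diagonal : ∀ p q → concat (Vector.toList (λ j → encodeEntry (+ mark q (suc (p + q)) j)))
  ≡ entries p 0F ++ entry 2F ++ entries q 0F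
encodeMark-diagonal zero q = cong₂ _++_ (cong (λ x → encodeEntry (+ x)) (mark-head-≡ q))
  (concat-tabulate-replicate q (λ j → cong (λ x → encodeEntry (+ x)) (mark-≢ q j (ℕₚ.<⇒≢ (toℕ<n (opposite j))))))
encodeMark-diagonal (suc p) q = trans
  (cong₂ _++_ (cong (λ x → encodeEntry (+ x)) (mark-head-≢ {q} {suc p + q} (λ e → ℕₚ.m≢1+n+m q (sym e)))) (encodeMark-diagonal p q))
  (sym (++-assoc (entry 0F) (entries p 0F) _))

encodeRow-row : ∀ p q w → encodeRow (row (p + q) w q) ≡ numberEntry (bits w) ++ diagonalEntries p q
encodeRow-row p q w = trans (++-assoc (encodeEntry (+ (2 * w))) _ _)
  (cong₂ _++_ (encodeEntry-double w)
    (trans (cong (_++ semicolon ∷ []) (encodeMark-diagonal p q))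
      (trans (++-assoc (entries p 0F) _ _) (cong (entries p 0F ++_) (++-assoc (entry 2F) (entries q 0F) _)))))

-- `q` rows are done and `suc n` remain, counting that of the added weight; together they are the
-- `m` weights.
encodeRows : ∀ {m} n (a : Vector ℕ n) q → suc n + q ≡ m →
  concat (Vector.toList (λ i → encodeRow (row m (snoc a 0 i) (q + toℕ i))))
  ≡ rows (Vector.toList (λ i → bits (a i))) q
encodeRows zero    a q refl rewrite ℕₚ.+-identityʳ q = trans (++-identityʳ _) (encodeRow-row 1 q 0)
encodeRows {m} (suc n) a q refl = begin
  encodeRow (row m (a zero) (q + 0)) ++ concat (Vector.toList λ i → encodeRow (row m (snoc a′ 0 i) (q + suc (toℕ i))))
    ≡⟨ cong₂ (λ r t → encodeRow (row m (a zero) r) ++ concat t) (ℕₚ.+-identityʳ q)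
         (tabulate-cong (λ i → cong (λ r → encodeRow (row m (snoc a′ 0 i) r)) (ℕₚ.+-suc q (toℕ i)))) ⟩
  encodeRow (row m (a zero) q) ++ concat (Vector.toList λ i → encodeRow (row m (snoc a′ 0 i) (suc q + toℕ i)))
    ≡⟨ cong₂ _++_ (encodeRow-row (2 + n) q (a zero)) (encodeRows n a′ (suc q) (cong suc (ℕₚ.+-suc n q))) ⟩
  (numberEntry (bits (a zero)) ++ diagonalEntries (2 + n) q) ++ rows l (suc q)
    ≡⟨ ++-assoc (numberEntry (bits (a zero))) _ _ ⟩
  numberEntry (bits (a zero)) ++ diagonalEntries (2 + n) q ++ rows l (suc q)
    ≡⟨ cong (λ k → numberEntry (bits (a zero)) ++ diagonalEntries (2 + k) q ++ rows l (suc q)) (length-tabulate (λ i → bits (a′ i))) ⟨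
  numberEntry (bits (a zero)) ++ diagonalEntries (2 + length l) q ++ rows l (suc q) ∎
  where
  open ≡-Reasoning
  a′ = Vector.tail a
  l = Vector.toList (λ i → bits (a′ i))

encodeNumbers : ∀ {n} (a : Vector ℕ n) →
  encodeVector encodeℕ comma a ≡ numbers (Vector.toList (λ i → bits (a i)))
encodeNumbers {zero}  a = refl
encodeNumbers {suc n} a = trans (++-assoc (encodeℕ (a zero)) _ _)
  (cong (λ w → encodeℕ (a zero) ++ comma ∷ w) (encodeNumbers (Vector.tail a)))

encodeFirstRow : ∀ {m} s (w : Vector ℕ m) → encodeRow (matrix s w zero) ≡ numberEntry (bits s) ++ entries (suc m) 1F ++ semicolon ∷ []
encodeFirstRow {m} s w = trans (++-assoc (encodeEntry (+ (2 * s))) _ _)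
  (cong₂ _++_ (encodeEntry-double s) (cong (_++ semicolon ∷ []) (concat-tabulate-replicate (suc m) {u = entry 1F} (λ _ → refl))))

-- The reduction

reduce : SSInstance → GapSVPInstance
reduce I = record { lattice = latticeOf s (snoc a 0) ; δ = 1ℚ }
  where open SSInstance I

encode-reduce : ∀ γ I → let open SSInstance I in
  PromiseProblem.encode (GapSVP∞ γ) (reduce I) ≡ result (bits s) (Vector.toList (λ i → bits (a i)))
encode-reduce γ I = cong (header ++_) (cong₂ _++_
  (trans (encodeFirstRow s (snoc a 0)) (cong (λ k → numberEntry (bits s) ++ entries (2 + k) 1F ++ semicolon ∷ []) (sym (length-tabulate (λ i → bits (a i))))))
  (encodeRows n a 0 (ℕₚ.+-identityʳ (suc n))))
  where open SSInstance I

-- The order on cuts asks for a rational strictly in between: for a rational q with 0 < q < ε, take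
-- 2 - q.
gap-upper : ∀ (ε : ℝ) → fromℚ 0ℚ <ℝ ε → ((+ 2 / 1) -ℝ ε) ·ℝ 1ℚ <ℝ fromℚ 2ℚ
gap-upper ε (q , 0<q , ε>q) = 2ℚ ℚ.- q , subst (ℝ.L ε) (sym difference) ε>q , 2-q<2
  where
  difference : 2ℚ ℚ.- (2ℚ ℚ.- q) ℚ.* 1ℚ ≡ q
  difference = begin
    2ℚ ℚ.- (2ℚ ℚ.- q) ℚ.* 1ℚ ≡⟨ cong (λ x → 2ℚ ℚ.- x) (ℚₚ.*-identityʳ (2ℚ ℚ.- q)) ⟩
    2ℚ ℚ.- (2ℚ ℚ.- q)        ≡⟨ cong (λ x → 2ℚ ℚ.+ x) (trans (ℚₚ.neg-distrib-+ 2ℚ (ℚ.- q)) (cong (ℚ.- 2ℚ ℚ.+_) (⁻¹-involutive q))) ⟩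
    2ℚ ℚ.+ (ℚ.- 2ℚ ℚ.+ q)    ≡⟨ ℚₚ.+-assoc 2ℚ (ℚ.- 2ℚ) q ⟨
    2ℚ ℚ.- 2ℚ ℚ.+ q          ≡⟨ ℚₚ.+-identityˡ q ⟩
    q                        ∎
    where
    open ≡-Reasoning
    open import Algebra.Properties.Group ℚₚ.+-0-group using (⁻¹-involutive)
  2-q<2 : 2ℚ ℚ.- q ℚ.< 2ℚ
  2-q<2 = ℚₚ.+-monoʳ-< 2ℚ (ℚₚ.neg-antimono-< 0<q)

theorem1p5 :
    (ε : ℝ) → fromℚ 0ℚ <ℝ ε → ε ≤ℝ fromℚ 1ℚ →
    Σ ℕ λ C → Σ (SS ≤ᴷᵃʳᵖ GapSVP∞ ((+ 2 / 1) -ℝ ε)) λ R →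
    ∀ (I : SSInstance) →
    GapSVPInstance.rank (_≤ᴷᵃʳᵖ_.reduce R I) ≤ C * SSInstance.n I
theorem1p5 ε 0<ε _ = 3 , reduction , rank≤
  where
  γ = (+ 2 / 1) -ℝ ε
  reduction : SS ≤ᴷᵃʳᵖ GapSVP∞ γ
  reduction = record
    { reduce   = reduce
    ; polyTime = machine , 62 , 2 , λ I → let open SSInstance I in
        subst₂ (λ w v → Computes w ↦ v within (62 * length w ^ 2 + 62))
          (cong (λ w → encodeℕ s ++ comma ∷ w) (sym (encodeNumbers a)))
          (sym (encode-reduce γ I))
          (machine-computes (bits s) (Vector.toList (λ i → bits (a i))))
    ; yes      = λ I x → let open SSInstance I in
        1ℚ , λ₁≡1 s (snoc a 0) (subsetSum-snoc s a x) , ℚₚ.≤-refl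
    ; no       = λ I ∄x → let open SSInstance I in
        2ℚ , λ₁≡2 s a ∄x , gap-upper ε 0<ε
    }
  -- The basis has a vector for `s`, for each weight and for the added weight; n ≥ 1 absorbs the 2.
  rank≤ : ∀ I → 2 + SSInstance.n I ≤ 3 * SSInstance.n I
  rank≤ I = begin
    2 + n      ≡⟨ ℕₚ.+-comm 2 n ⟩
    n + 2 * 1  ≤⟨ ℕₚ.+-monoʳ-≤ n (ℕₚ.*-monoʳ-≤ 2 (>-nonZero⁻¹ n)) ⟩
    3 * n      ∎
    where
    open SSInstance I
    open ℕₚ.≤-Reasoning
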